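{- For every $k\ge2$ and every $\varepsilon>0$, every $(1+\varepsilon)$-consistent deterministic algorithm for $k$ servers on the real line has robustness at least \[ L_k(\varepsilon)=1+\sum_{j=1}^{k-1}\frac{2^{\,j+1}}{\varepsilon^{\,j}} =1+\frac4\varepsilon+\frac8{\varepsilon^2}+\dots+\frac{2^k}{\varepsilon^{k-1}} . \] That is, if such an algorithm is $r$-robust, then $r\ge L_k(\varepsilon)$.
   Context: Online metric matching with action predictions on the real line. There are $k$ labelled servers $S$ at fixed points of $\mathbb R$ (labels stay distinct even if locations coincide), known in advance; an algorithm must handle every placement of the $k$ servers on $\mathbb R$. Requests $r_1,\dots,r_k\in\mathbb R$ arrive one by one; request $r_t$ arrives together with a predicted server $p_t\in S$, visible before the algorithm acts. Each request must be matched immediately and irrevocably to a currently free server $w$, at cost $|r_t-w|$. $\mathrm{cost}$ is the total cost of the algorithm, and $\mathrm{OPT}$ is the minimum cost of an offline perfect matching of requests to servers. A prediction sequence is perfect if some offline optimal matching $M^*$ has $p_t=M^*(r_t)$ for every $t$. A deterministic algorithm is $c$-consistent if $\mathrm{cost}\le c\cdot\mathrm{OPT}$ on every instance with a perfect prediction sequence, and $r$-robust (has robustness $r$) if $\mathrm{cost}\le r\cdot\mathrm{OPT}$ on every instance, with arbitrary predictions (when $\mathrm{OPT}=0$ both require cost $0$). -}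

module Defs where

open import Data.Fin.Base as Fin using (Fin; Fin′; toℕ; inject)
open import Data.Fin.Permutation using (Permutation′; _⟨$⟩ʳ_)
open import Data.Nat.Base as ℕ using (ℕ; zero; suc)
import Data.Nat.Properties as ℕ
open import Data.Product.Base using (Σ; ∃; _×_; _,_; proj₁; proj₂)
open import Data.Rational.Base as ℚ using (ℚ; 0ℚ; 1ℚ; ½)
import Data.Rational.Properties as ℚ
open import Data.Rational.Solver using (module +-*-Solver)
open import Data.Sum.Base using (inj₁; inj₂)
open import Data.Vec.Functional using (Vector; foldr)
open import Relation.Binary.PropositionalEquality
  using (_≡_; _≢_; refl; sym; trans; cong; cong₂; subst; subst₂)
open import Relation.Nullary.Negation.Core using (¬_)

-- ℝ is the type of Cauchy sequences of rationals, with setoid equality _≈_.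

IsCauchy : (ℕ → ℚ) → Set
IsCauchy x = ∀ δ → 0ℚ ℚ.< δ →
  ∃ λ N → ∀ m n → N ℕ.≤ m → N ℕ.≤ n → ℚ.∣ x m ℚ.- x n ∣ ℚ.< δ

record ℝ : Set where
  constructor mkℝ
  field
    seq    : ℕ → ℚ
    cauchy : IsCauchy seq

open ℝ public

infix 4 _≈_ _<_ _≤_

_≈_ : ℝ → ℝ → Set
x ≈ y = ∀ δ → 0ℚ ℚ.< δ →
  ∃ λ N → ∀ n → N ℕ.≤ n → ℚ.∣ seq x n ℚ.- seq y n ∣ ℚ.< δ

_<_ : ℝ → ℝ → Set
x < y = ∃ λ δ → 0ℚ ℚ.< δ ×
  ∃ λ N → ∀ n → N ℕ.≤ n → seq x n ℚ.+ δ ℚ.≤ seq y n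

_≤_ : ℝ → ℝ → Set
x ≤ y = ¬ (y < x)

private

  half-pos : ∀ {δ} → 0ℚ ℚ.< δ → 0ℚ ℚ.< δ ℚ.* ½
  half-pos {δ} 0<δ = ℚ.positive⁻¹ (δ ℚ.* ½)
    {{ℚ.pos*pos⇒pos δ {{ℚ.positive 0<δ}} ½}}

  half+half : ∀ δ → δ ℚ.* ½ ℚ.+ δ ℚ.* ½ ≡ δ
  half+half = solve 1 (λ δ → δ :* con ½ :+ δ :* con ½ := δ) refl
    where open +-*-Solver

  abstract

    const-cauchy : ∀ q → IsCauchy (λ _ → q)
    const-cauchy q δ 0<δ = 0 , λ _ _ _ _ →
      subst (ℚ._< δ) (sym (cong ℚ.∣_∣ (ℚ.+-inverseʳ q))) 0<δ

  abstract

    +-cauchy : ∀ x y → IsCauchy x → IsCauchy y → IsCauchy (λ n → x n ℚ.+ y n)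
    +-cauchy x y cx cy δ 0<δ with cx (δ ℚ.* ½) (half-pos 0<δ) | cy (δ ℚ.* ½) (half-pos 0<δ)
    ... | M , p | N , q = M ℕ.+ N , λ m n lm ln →
      subst₂ ℚ._<_ (cong ℚ.∣_∣ (rearrange (x m) (y m) (x n) (y n))) (half+half δ)
        (ℚ.≤-<-trans (ℚ.∣p+q∣≤∣p∣+∣q∣ (x m ℚ.- x n) (y m ℚ.- y n))
          (ℚ.+-mono-< (p m n (ℕ.m+n≤o⇒m≤o M lm) (ℕ.m+n≤o⇒m≤o M ln))
                      (q m n (ℕ.m+n≤o⇒n≤o M lm) (ℕ.m+n≤o⇒n≤o M ln))))
      where
      open +-*-Solver
      rearrange : ∀ a b c d → (a ℚ.- c) ℚ.+ (b ℚ.- d) ≡ (a ℚ.+ b) ℚ.- (c ℚ.+ d)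
      rearrange = solve 4 (λ a b c d → (a :- c) :+ (b :- d) := (a :+ b) :- (c :+ d)) refl

  ∣-∣-swap : ∀ a b → ℚ.∣ a ℚ.- b ∣ ≡ ℚ.∣ b ℚ.- a ∣
  ∣-∣-swap a b = begin
    ℚ.∣ a ℚ.- b ∣          ≡⟨ ℚ.∣-p∣≡∣p∣ (a ℚ.- b) ⟨
    ℚ.∣ ℚ.- (a ℚ.- b) ∣    ≡⟨ cong ℚ.∣_∣ (solve 2 (λ a b → :- (a :- b) := b :- a) refl a b) ⟩
    ℚ.∣ b ℚ.- a ∣          ∎
    where
    open +-*-Solver
    open Relation.Binary.PropositionalEquality.≡-Reasoning

  abstract

    neg-cauchy : ∀ x → IsCauchy x → IsCauchy (λ n → ℚ.- x n)
    neg-cauchy x cx δ 0<δ with cx δ 0<δ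
    ... | N , p = N , λ m n lm ln →
      subst (ℚ._< δ) (cong ℚ.∣_∣ (rearrange (x n) (x m))) (p n m ln lm)
      where
      open +-*-Solver
      rearrange : ∀ a b → a ℚ.- b ≡ (ℚ.- b) ℚ.- (ℚ.- a)
      rearrange = solve 2 (λ a b → a :- b := (:- b) :- (:- a)) refl

  ∣a∣≤∣a-b∣+∣b∣ : ∀ a b → ℚ.∣ a ∣ ℚ.≤ ℚ.∣ a ℚ.- b ∣ ℚ.+ ℚ.∣ b ∣
  ∣a∣≤∣a-b∣+∣b∣ a b =
    subst (λ c → ℚ.∣ c ∣ ℚ.≤ ℚ.∣ a ℚ.- b ∣ ℚ.+ ℚ.∣ b ∣)
      (solve 2 (λ a b → (a :- b) :+ b := a) refl a b)
      (ℚ.∣p+q∣≤∣p∣+∣q∣ (a ℚ.- b) b)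
    where open +-*-Solver

  ∣a∣-∣b∣≤∣a-b∣ : ∀ a b → ℚ.∣ a ∣ ℚ.- ℚ.∣ b ∣ ℚ.≤ ℚ.∣ a ℚ.- b ∣
  ∣a∣-∣b∣≤∣a-b∣ a b =
    subst (ℚ.∣ a ∣ ℚ.- ℚ.∣ b ∣ ℚ.≤_)
      (solve 2 (λ u v → (u :+ v) :- v := u) refl ℚ.∣ a ℚ.- b ∣ ℚ.∣ b ∣)
      (ℚ.+-monoˡ-≤ (ℚ.- ℚ.∣ b ∣) (∣a∣≤∣a-b∣+∣b∣ a b))
    where open +-*-Solver

  ∣∣a∣-∣b∣∣≤∣a-b∣ : ∀ a b → ℚ.∣ ℚ.∣ a ∣ ℚ.- ℚ.∣ b ∣ ∣ ℚ.≤ ℚ.∣ a ℚ.- b ∣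
  ∣∣a∣-∣b∣∣≤∣a-b∣ a b with ℚ.∣p∣≡p∨∣p∣≡-p (ℚ.∣ a ∣ ℚ.- ℚ.∣ b ∣)
  ... | inj₁ e = subst (ℚ._≤ ℚ.∣ a ℚ.- b ∣) (sym e) (∣a∣-∣b∣≤∣a-b∣ a b)
  ... | inj₂ e = subst₂ ℚ._≤_
    (subst (λ c → ℚ.∣ b ∣ ℚ.- ℚ.∣ a ∣ ≡ c) (sym e)
      (solve 2 (λ u v → v :- u := :- (u :- v)) refl ℚ.∣ a ∣ ℚ.∣ b ∣))
    (∣-∣-swap b a) (∣a∣-∣b∣≤∣a-b∣ b a)
    where open +-*-Solver

  abstract

    abs-cauchy : ∀ x → IsCauchy x → IsCauchy (λ n → ℚ.∣ x n ∣)
    abs-cauchy x cx δ 0<δ with cx δ 0<δ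
    ... | N , p = N , λ m n lm ln →
      ℚ.≤-<-trans (∣∣a∣-∣b∣∣≤∣a-b∣ (x m) (x n)) (p m n lm ln)

  bounded : ∀ x → IsCauchy x →
    ∃ λ B → 0ℚ ℚ.< B × ∃ λ N → ∀ n → N ℕ.≤ n → ℚ.∣ x n ∣ ℚ.≤ B
  bounded x cx with cx 1ℚ (ℚ.positive⁻¹ 1ℚ)
  ... | N , p = 1ℚ ℚ.+ ℚ.∣ x N ∣
    , ℚ.<-≤-trans (ℚ.positive⁻¹ 1ℚ)
        (subst (ℚ._≤ 1ℚ ℚ.+ ℚ.∣ x N ∣) (ℚ.+-identityʳ 1ℚ)
          (ℚ.+-monoʳ-≤ 1ℚ (ℚ.0≤∣p∣ (x N))))
    , N , λ n ln → ℚ.≤-trans (∣a∣≤∣a-b∣+∣b∣ (x n) (x N))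
        (ℚ.+-monoˡ-≤ ℚ.∣ x N ∣ (ℚ.<⇒≤ (p n N ln ℕ.≤-refl)))

  *-mono-nonNeg : ∀ {a b c d} → 0ℚ ℚ.≤ b → 0ℚ ℚ.≤ c →
    a ℚ.≤ b → c ℚ.≤ d → a ℚ.* c ℚ.≤ b ℚ.* d
  *-mono-nonNeg {a} {b} {c} {d} 0≤b 0≤c a≤b c≤d = ℚ.≤-trans
    (ℚ.*-monoʳ-≤-nonNeg c {{ℚ.nonNegative 0≤c}} a≤b)
    (ℚ.*-monoˡ-≤-nonNeg b {{ℚ.nonNegative 0≤b}} c≤d)

  -- Scaling δ down so that multiplying by the bound B stays below δ.
  shrink : ∀ δ B → 0ℚ ℚ.< δ → 0ℚ ℚ.< B → ∃ λ η → 0ℚ ℚ.< η × B ℚ.* η ≡ δ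
  shrink δ B 0<δ 0<B = B⁻¹ ℚ.* δ
    , ℚ.positive⁻¹ (B⁻¹ ℚ.* δ)
        {{ℚ.pos*pos⇒pos B⁻¹ {{ℚ.1/pos⇒pos B {{posB}}}} δ {{ℚ.positive 0<δ}}}}
    , (begin
        B ℚ.* (B⁻¹ ℚ.* δ)  ≡⟨ ℚ.*-assoc B B⁻¹ δ ⟨
        B ℚ.* B⁻¹ ℚ.* δ    ≡⟨ cong (ℚ._* δ) (ℚ.*-inverseʳ B {{nzB}}) ⟩
        1ℚ ℚ.* δ           ≡⟨ ℚ.*-identityˡ δ ⟩
        δ                  ∎)
    where
    open Relation.Binary.PropositionalEquality.≡-Reasoning
    posB = ℚ.positive 0<B
    nzB  = ℚ.pos⇒nonZero B {{posB}}
    B⁻¹  = (ℚ.1/ B) {{nzB}}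

  *-distribˡ-- : ∀ a b c → a ℚ.* (b ℚ.- c) ≡ a ℚ.* b ℚ.- a ℚ.* c
  *-distribˡ-- a b c = trans (ℚ.*-distribˡ-+ a b (ℚ.- c))
    (cong (a ℚ.* b ℚ.+_) (sym (ℚ.neg-distribʳ-* a c)))

  *-rearrange : ∀ a b c d → a ℚ.* (b ℚ.- d) ℚ.+ d ℚ.* (a ℚ.- c) ≡ a ℚ.* b ℚ.- c ℚ.* d
  *-rearrange a b c d = begin
    a ℚ.* (b ℚ.- d) ℚ.+ d ℚ.* (a ℚ.- c)
      ≡⟨ cong₂ ℚ._+_ (*-distribˡ-- a b d) (*-distribˡ-- d a c) ⟩
    (a ℚ.* b ℚ.- a ℚ.* d) ℚ.+ (d ℚ.* a ℚ.- d ℚ.* c)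
      ≡⟨ cong₂ (λ u v → (a ℚ.* b ℚ.- a ℚ.* d) ℚ.+ (u ℚ.- v)) (ℚ.*-comm d a) (ℚ.*-comm d c) ⟩
    (a ℚ.* b ℚ.- a ℚ.* d) ℚ.+ (a ℚ.* d ℚ.- c ℚ.* d)
      ≡⟨ telescope (a ℚ.* b) (a ℚ.* d) (c ℚ.* d) ⟩
    a ℚ.* b ℚ.- c ℚ.* d ∎
    where
    open +-*-Solver
    open Relation.Binary.PropositionalEquality.≡-Reasoning
    telescope : ∀ p q r → (p ℚ.- q) ℚ.+ (q ℚ.- r) ≡ p ℚ.- r
    telescope = solve 3 (λ p q r → (p :- q) :+ (q :- r) := p :- r) refl

  *-small : ∀ {C γ η} → 0ℚ ℚ.< C → C ℚ.* γ ≡ η → ∀ u v →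
    ℚ.∣ u ∣ ℚ.≤ C → ℚ.∣ v ∣ ℚ.< γ → ℚ.∣ u ℚ.* v ∣ ℚ.< η
  *-small {C} 0<C Cγ u v u≤C v<γ = subst₂ ℚ._<_ (sym (ℚ.∣p*q∣≡∣p∣*∣q∣ u v)) Cγ
    (ℚ.≤-<-trans
      (ℚ.*-monoʳ-≤-nonNeg ℚ.∣ v ∣ {{ℚ.∣-∣-nonNeg v}} u≤C)
      (ℚ.*-monoʳ-<-pos C {{ℚ.positive 0<C}} v<γ))

  *-close : ∀ {A B α β η} → 0ℚ ℚ.< A → 0ℚ ℚ.< B → A ℚ.* α ≡ η → B ℚ.* β ≡ η →
    ∀ a b c d → ℚ.∣ a ∣ ℚ.≤ A → ℚ.∣ d ∣ ℚ.≤ B →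
    ℚ.∣ b ℚ.- d ∣ ℚ.< α → ℚ.∣ a ℚ.- c ∣ ℚ.< β →
    ℚ.∣ a ℚ.* b ℚ.- c ℚ.* d ∣ ℚ.< η ℚ.+ η
  *-close {η = η} 0<A 0<B Aα Bβ a b c d a≤A d≤B b-d a-c =
    subst (λ e → ℚ.∣ e ∣ ℚ.< η ℚ.+ η) (*-rearrange a b c d)
      (ℚ.≤-<-trans (ℚ.∣p+q∣≤∣p∣+∣q∣ (a ℚ.* (b ℚ.- d)) (d ℚ.* (a ℚ.- c)))
        (ℚ.+-mono-< (*-small 0<A Aα a (b ℚ.- d) a≤A b-d)
                    (*-small 0<B Bβ d (a ℚ.- c) d≤B a-c)))

  abstract

    *-cauchy : ∀ x y → IsCauchy x → IsCauchy y → IsCauchy (λ n → x n ℚ.* y n)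
    *-cauchy x y cx cy δ 0<δ = from-bounds (bounded x cx) (bounded y cy)
      where
      η : ℚ
      η = δ ℚ.* ½

      Goal : Set
      Goal = ∃ λ N → ∀ m n → N ℕ.≤ m → N ℕ.≤ n →
        ℚ.∣ x m ℚ.* y m ℚ.- x n ℚ.* y n ∣ ℚ.< δ

      Bounds : (ℕ → ℚ) → Set
      Bounds z = ∃ λ B → 0ℚ ℚ.< B × ∃ λ N → ∀ n → N ℕ.≤ n → ℚ.∣ z n ∣ ℚ.≤ B

      from-bounds : Bounds x → Bounds y → Goal
      from-bounds (A , 0<A , M₁ , bx) (B , 0<B , N₁ , by) =
        from-scales (shrink η A (half-pos 0<δ) 0<A) (shrink η B (half-pos 0<δ) 0<B)
        where
        from-scales : (∃ λ α → 0ℚ ℚ.< α × A ℚ.* α ≡ η) → (∃ λ β → 0ℚ ℚ.< β × B ℚ.* β ≡ η) → Goal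
        from-scales (α , 0<α , Aα) (β , 0<β , Bβ) = from-moduli (cx β 0<β) (cy α 0<α)
          where
          from-moduli :
            (∃ λ M → ∀ m n → M ℕ.≤ m → M ℕ.≤ n → ℚ.∣ x m ℚ.- x n ∣ ℚ.< β) →
            (∃ λ N → ∀ m n → N ℕ.≤ m → N ℕ.≤ n → ℚ.∣ y m ℚ.- y n ∣ ℚ.< α) → Goal
          from-moduli (M₂ , px) (N₂ , py) = (M₁ ℕ.+ M₂) ℕ.+ (N₁ ℕ.+ N₂) , λ m n lm ln →
            let M≤m = ℕ.m+n≤o⇒m≤o (M₁ ℕ.+ M₂) lm
                M≤n = ℕ.m+n≤o⇒m≤o (M₁ ℕ.+ M₂) ln
                N≤m = ℕ.m+n≤o⇒n≤o (M₁ ℕ.+ M₂) lm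
                N≤n = ℕ.m+n≤o⇒n≤o (M₁ ℕ.+ M₂) ln
            in subst (ℚ.∣ x m ℚ.* y m ℚ.- x n ℚ.* y n ∣ ℚ.<_) (half+half δ)
                 (*-close 0<A 0<B Aα Bβ (x m) (y m) (x n) (y n)
                   (bx m (ℕ.m+n≤o⇒m≤o M₁ M≤m)) (by n (ℕ.m+n≤o⇒m≤o N₁ N≤n))
                   (py m n (ℕ.m+n≤o⇒n≤o N₁ N≤m) (ℕ.m+n≤o⇒n≤o N₁ N≤n))
                   (px m n (ℕ.m+n≤o⇒n≤o M₁ M≤m) (ℕ.m+n≤o⇒n≤o M₁ M≤n)))

infixl 6 _+_ _-_
infixl 7 _*_
infixr 8 _^_

fromℚ : ℚ → ℝ
fromℚ q = mkℝ (λ _ → q) (const-cauchy q)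

0ℝ 1ℝ 2ℝ : ℝ
0ℝ = fromℚ 0ℚ
1ℝ = fromℚ 1ℚ
2ℝ = fromℚ (1ℚ ℚ.+ 1ℚ)

_+_ _*_ : ℝ → ℝ → ℝ
x + y = mkℝ (λ n → seq x n ℚ.+ seq y n) (+-cauchy (seq x) (seq y) (cauchy x) (cauchy y))
x * y = mkℝ (λ n → seq x n ℚ.* seq y n) (*-cauchy (seq x) (seq y) (cauchy x) (cauchy y))

-_ ∣_∣ : ℝ → ℝ
- x = mkℝ (λ n → ℚ.- seq x n) (neg-cauchy (seq x) (cauchy x))
∣ x ∣ = mkℝ (λ n → ℚ.∣ seq x n ∣) (abs-cauchy (seq x) (cauchy x))

_-_ : ℝ → ℝ → ℝ
x - y = x + (- y)

_^_ : ℝ → ℕ → ℝ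
x ^ zero  = 1ℝ
x ^ suc n = x * x ^ n

∑ : ∀ {n} → Vector ℝ n → ℝ
∑ = foldr _+_ 0ℝ

private

  -- x shifted to a tail on which it is bounded below by a positive rational.
  module Inverse (x : ℝ) (0<x : 0ℝ < x) where

    c     = proj₁ 0<x
    0<c   = proj₁ (proj₂ 0<x)
    start = proj₁ (proj₂ (proj₂ 0<x))

    tail : ℕ → ℚ
    tail n = seq x (start ℕ.+ n)

    c≤tail : ∀ n → c ℚ.≤ tail n
    c≤tail n = subst (ℚ._≤ tail n) (ℚ.+-identityˡ c)
      (proj₂ (proj₂ (proj₂ 0<x)) (start ℕ.+ n) (ℕ.m≤m+n start n))

    tail-pos : ∀ n → ℚ.Positive (tail n)
    tail-pos n = ℚ.positive (ℚ.<-≤-trans 0<c (c≤tail n))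

    tail-nonZero : ∀ n → ℚ.NonZero (tail n)
    tail-nonZero n = ℚ.pos⇒nonZero (tail n) {{tail-pos n}}

    inv : ℕ → ℚ
    inv n = (ℚ.1/ tail n) {{tail-nonZero n}}

    inv-pos : ∀ n → ℚ.Positive (inv n)
    inv-pos n = ℚ.1/pos⇒pos (tail n) {{tail-pos n}}

    tail*inv : ∀ n → tail n ℚ.* inv n ≡ 1ℚ
    tail*inv n = ℚ.*-inverseʳ (tail n) {{tail-nonZero n}}

    scale : ∀ n d → 0ℚ ℚ.≤ d → c ℚ.* (inv n ℚ.* d) ℚ.≤ d
    scale n d 0≤d = subst (c ℚ.* (inv n ℚ.* d) ℚ.≤_) cancel
      (ℚ.*-monoʳ-≤-nonNeg (inv n ℚ.* d)
        {{ℚ.nonNegative 0≤inv*d}} (c≤tail n))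
      where
      open Relation.Binary.PropositionalEquality.≡-Reasoning
      0≤inv*d : 0ℚ ℚ.≤ inv n ℚ.* d
      0≤inv*d = subst (ℚ._≤ inv n ℚ.* d) (ℚ.*-zeroʳ (inv n))
        (ℚ.*-monoˡ-≤-nonNeg (inv n) {{ℚ.pos⇒nonNeg (inv n) {{inv-pos n}}}} 0≤d)
      cancel : tail n ℚ.* (inv n ℚ.* d) ≡ d
      cancel = begin
        tail n ℚ.* (inv n ℚ.* d)  ≡⟨ ℚ.*-assoc (tail n) (inv n) d ⟨
        tail n ℚ.* inv n ℚ.* d    ≡⟨ cong (ℚ._* d) (tail*inv n) ⟩
        1ℚ ℚ.* d                  ≡⟨ ℚ.*-identityˡ d ⟩
        d                         ∎

    ∣inv*v∣ : ∀ n v → c ℚ.* ℚ.∣ inv n ℚ.* v ∣ ℚ.≤ ℚ.∣ v ∣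
    ∣inv*v∣ n v = subst (λ d → c ℚ.* d ℚ.≤ ℚ.∣ v ∣) (sym eq)
      (scale n ℚ.∣ v ∣ (ℚ.0≤∣p∣ v))
      where
      eq : ℚ.∣ inv n ℚ.* v ∣ ≡ inv n ℚ.* ℚ.∣ v ∣
      eq = subst (λ d → ℚ.∣ inv n ℚ.* v ∣ ≡ d ℚ.* ℚ.∣ v ∣)
        (ℚ.0≤p⇒∣p∣≡p (ℚ.<⇒≤ (ℚ.positive⁻¹ (inv n) {{inv-pos n}})))
        (ℚ.∣p*q∣≡∣p∣*∣q∣ (inv n) v)

    c-nonNeg : ℚ.NonNegative c
    c-nonNeg = ℚ.nonNegative (ℚ.<⇒≤ 0<c)

    inv-diff : ∀ m n → inv m ℚ.* (inv n ℚ.* (tail n ℚ.- tail m)) ≡ inv m ℚ.- inv n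
    inv-diff m n = begin
      inv m ℚ.* (inv n ℚ.* (tail n ℚ.- tail m))
        ≡⟨ cong (inv m ℚ.*_) (*-distribˡ-- (inv n) (tail n) (tail m)) ⟩
      inv m ℚ.* (inv n ℚ.* tail n ℚ.- inv n ℚ.* tail m)
        ≡⟨ *-distribˡ-- (inv m) (inv n ℚ.* tail n) (inv n ℚ.* tail m) ⟩
      inv m ℚ.* (inv n ℚ.* tail n) ℚ.- inv m ℚ.* (inv n ℚ.* tail m)
        ≡⟨ cong₂ (λ u v → inv m ℚ.* u ℚ.- v)
             (trans (ℚ.*-comm (inv n) (tail n)) (tail*inv n))
             (trans (ℚ.*-comm (inv m) (inv n ℚ.* tail m))
               (trans (ℚ.*-assoc (inv n) (tail m) (inv m))
                 (cong (inv n ℚ.*_) (tail*inv m)))) ⟩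
      inv m ℚ.* 1ℚ ℚ.- inv n ℚ.* 1ℚ
        ≡⟨ cong₂ ℚ._-_ (ℚ.*-identityʳ (inv m)) (ℚ.*-identityʳ (inv n)) ⟩
      inv m ℚ.- inv n ∎
      where
      open Relation.Binary.PropositionalEquality.≡-Reasoning

    abstract

      inv-cauchy : IsCauchy inv
      inv-cauchy δ 0<δ with cauchy x (c ℚ.* (c ℚ.* δ)) (*-pos (*-pos 0<δ))
        where
        *-pos : ∀ {d} → 0ℚ ℚ.< d → 0ℚ ℚ.< c ℚ.* d
        *-pos {d} 0<d = ℚ.positive⁻¹ (c ℚ.* d)
          {{ℚ.pos*pos⇒pos c {{ℚ.positive 0<c}} d {{ℚ.positive 0<d}}}}
      ... | N , p = N , λ m n lm ln →
        subst (λ d → ℚ.∣ d ∣ ℚ.< δ) (inv-diff m n)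
          (ℚ.*-cancelˡ-<-nonNeg c {{c-nonNeg}}
            (ℚ.≤-<-trans (∣inv*v∣ m (inv n ℚ.* (tail n ℚ.- tail m)))
              (ℚ.*-cancelˡ-<-nonNeg c {{c-nonNeg}}
                (ℚ.≤-<-trans (∣inv*v∣ n (tail n ℚ.- tail m))
                  (p (start ℕ.+ n) (start ℕ.+ m)
                    (ℕ.≤-trans ln (ℕ.m≤n+m n start))
                    (ℕ.≤-trans lm (ℕ.m≤n+m m start)))))))

-- The inverse of a positive real: its n-th term is the reciprocal of the
-- (N + n)-th term of x, where the witness of positivity bounds x below from N on.
inverse : (x : ℝ) → 0ℝ < x → ℝ
inverse x 0<x = mkℝ (Inverse.inv x 0<x) (Inverse.inv-cauchy x 0<x)

infixl 7 _÷_⟨_⟩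

_÷_⟨_⟩ : ℝ → (y : ℝ) → 0ℝ < y → ℝ
x ÷ y ⟨ 0<y ⟩ = x * inverse y 0<y

*-positive : ∀ x y → 0ℝ < x → 0ℝ < y → 0ℝ < x * y
*-positive x y (a , 0<a , M , p) (b , 0<b , N , q) =
  a ℚ.* b
  , ℚ.positive⁻¹ (a ℚ.* b) {{ℚ.pos*pos⇒pos a {{ℚ.positive 0<a}} b {{ℚ.positive 0<b}}}}
  , M ℕ.+ N
  , λ n ln →
      let a≤x = subst (ℚ._≤ seq x n) (ℚ.+-identityˡ a) (p n (ℕ.m+n≤o⇒m≤o M ln))
          b≤y = subst (ℚ._≤ seq y n) (ℚ.+-identityˡ b) (q n (ℕ.m+n≤o⇒n≤o M ln))
      in subst (ℚ._≤ seq x n ℚ.* seq y n) (sym (ℚ.+-identityˡ (a ℚ.* b)))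
           (*-mono-nonNeg (ℚ.≤-trans (ℚ.<⇒≤ 0<a) a≤x) (ℚ.<⇒≤ 0<b) a≤x b≤y)

^-positive : ∀ x → 0ℝ < x → ∀ n → 0ℝ < x ^ n
^-positive x 0<x zero    = 1ℚ , ℚ.positive⁻¹ 1ℚ , 0 , λ _ _ → ℚ.≤-refl
^-positive x 0<x (suc n) = *-positive x (x ^ n) 0<x (^-positive x 0<x n)

-- Servers are labelled by Fin k and requests by their time of arrival in Fin k.

Placement : ℕ → Set
Placement k = Fin k → ℝ

record Arrival (k : ℕ) : Set where
  constructor arrival
  field
    request    : ℝ
    prediction : Fin k

record _≈ₐ_ {k : ℕ} (a b : Arrival k) : Set where
  constructor mk≈ₐ
  field
    request≈    : Arrival.request a ≈ Arrival.request b
    prediction≡ : Arrival.prediction a ≡ Arrival.prediction b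

record Instance (k : ℕ) : Set where
  constructor mkInstance
  field
    servers  : Placement k
    arrivals : Fin k → Arrival k

  request : Fin k → ℝ
  request t = Arrival.request (arrivals t)

  prediction : Fin k → Fin k
  prediction t = Arrival.prediction (arrivals t)

  past : (t : Fin k) → Fin′ t → Arrival k
  past t i = arrivals (inject i)

  costOf : (Fin k → Fin k) → ℝ
  costOf f = ∑ λ t → ∣ request t - servers (f t) ∣

open Instance public

-- The algorithm sees the placement, the arrivals strictly before time t and
-- the arrival at time t.  Its own earlier choices are determined by the past.
record Algorithm (k : ℕ) : Set where
  field
    choose : Placement k → (t : Fin k) → (Fin′ t → Arrival k) → Arrival k → Fin k

    choose-cong : ∀ {s s′} t {h h′ : Fin′ t → Arrival k} {a a′} →
      (∀ i → s i ≈ s′ i) → (∀ i → h i ≈ₐ h′ i) → a ≈ₐ a′ →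
      choose s t h a ≡ choose s′ t h′ a′

  run : Instance k → Fin k → Fin k
  run I t = choose (servers I) t (past I t) (arrivals I t)

  field
    free : ∀ I {i t} → i Fin.< t → run I t ≢ run I i

  cost : Instance k → ℝ
  cost I = costOf I (run I)

open Algorithm public using (choose; choose-cong; run; free; cost)

matchingCost : ∀ {k} → Instance k → Permutation′ k → ℝ
matchingCost I M = costOf I (M ⟨$⟩ʳ_)

IsOptimal : ∀ {k} → Instance k → Permutation′ k → Set
IsOptimal I M = ∀ M′ → matchingCost I M ≤ matchingCost I M′

IsOPT : ∀ {k} → Instance k → ℝ → Set
IsOPT I v = ∃ λ M → IsOptimal I M × v ≈ matchingCost I M

Perfect : ∀ {k} → Instance k → Set
Perfect {k} I = ∃ λ M → IsOptimal I M × (∀ t → prediction I t ≡ M ⟨$⟩ʳ t)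

Consistent : ∀ {k} → ℝ → Algorithm k → Set
Consistent c A = ∀ I → Perfect I → ∀ OPT → IsOPT I OPT → cost A I ≤ c * OPT

Robust : ∀ {k} → ℝ → Algorithm k → Set
Robust r A = ∀ I → ∀ OPT → IsOPT I OPT → cost A I ≤ r * OPT

-- The summation index j = 1, …, k - 1 is suc (toℕ i) for i : Fin (k ∸ 1).
L : ℕ → (ε : ℝ) → 0ℝ < ε → ℝ
L k ε 0<ε = 1ℝ + ∑ {k ℕ.∸ 1} λ i → term (suc (toℕ i))
  where
  term : ℕ → ℝ
  term j = (2ℝ ^ suc j) ÷ (ε ^ j) ⟨ ^-positive ε 0<ε j ⟩

-- Put server 0 at 0 and server m at d_m = 1 + c + ⋯ + c^m, with c slightly below 2/ε,
-- and let the first request be at 1.  Each further request is placed on the server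
-- just used.  The optimal matching behind the predictions expects a request at 0 later
-- on, and sends the requests so far to the used servers and the nearest unused server
-- d_m.  If the algorithm returns to server 0 before all other servers are used, it has
-- walked at least 2 d_{m-1} - 1; a request at 0 then costs it d_m more, while the perfect
-- prediction costs d_m - 1 = c d_{m-1}: the ratio 1 + 2/c exceeds 1 + ε.  So a consistent
-- algorithm first visits all the other servers and only then returns to 0, paying
-- 2 d_{k-1} - 1, whereas matching every request to the server it sits on, and the first
-- one to server 0, costs 1.  As c tends to 2/ε, 2 d_{k-1} - 1 tends to L_k(ε).

module Submission where

open import Defs
open import Data.Fin.Base as Fin using (Fin; toℕ; inject; inject₁; zero; suc)
import Data.Fin.Properties as Fin
open import Data.Fin.Permutation using
  (Permutation′; permutation; transpose; _⟨$⟩ʳ_; _⟨$⟩ˡ_; _∘ₚ_; inverseʳ)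
import Data.Fin.Permutation.Components as Components
open import Data.Nat.Base as ℕ using (ℕ; zero; suc; z≤n; s≤s)
import Data.Nat.Properties as ℕ
open import Data.Product.Base using (∃; _×_; _,_; proj₁; proj₂)
open import Data.Rational.Base as ℚ using (ℚ; 0ℚ; 1ℚ; ½)
import Data.Rational.Properties as ℚ
open import Data.Rational.Solver using (module +-*-Solver)
open import Data.Sum.Base using (_⊎_; inj₁; inj₂)
open import Function.Base using (_∘_)
open import Relation.Binary.PropositionalEquality
  using (_≡_; _≢_; refl; sym; trans; cong; cong₂; subst; subst₂; module ≡-Reasoning)
open import Relation.Binary.Definitions using (tri<; tri≈; tri>)
open import Relation.Nullary using (¬_; Dec; yes; no; contradiction)
open import Relation.Nullary.Decidable using (dec-true; dec-false; _×-dec_)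
open import Algebra.Properties.CommutativeMonoid.Sum ℚ.+-0-commutativeMonoid
  using (sum; sum-cong-≗; ∑-distrib-+; sum-permute)
open import Algebra.Definitions.RawSemiring ℚ.+-*-rawSemiring using () renaming (_^_ to _^ℚ_)

open +-*-Solver

-- Rational inequalities and absolute values

2ℚ : ℚ
2ℚ = 1ℚ ℚ.+ 1ℚ

0≤1 : 0ℚ ℚ.≤ 1ℚ
0≤1 = ℚ.<⇒≤ (ℚ.positive⁻¹ 1ℚ)

-- Linear estimates are obtained by adding known inequalities into `a ≤ b`; that the target has the
-- same slack is then a ring identity for the solver.
≤-from-difference : ∀ {a b x y} → a ℚ.≤ b → b ℚ.- a ≡ y ℚ.- x → x ℚ.≤ y
≤-from-difference {a} {b} {x} {y} a≤b eq = subst₂ ℚ._≤_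
  (solve 2 (λ a x → a :+ (x :- a) := x) refl a x)
  (trans (solve 3 (λ a b x → b :+ (x :- a) := (b :- a) :+ x) refl a b x)
    (trans (cong (ℚ._+ x) eq) (solve 2 (λ x y → (y :- x) :+ x := y) refl x y)))
  (ℚ.+-monoˡ-≤ (x ℚ.- a) a≤b)

≤⇒0≤difference : ∀ {a b} → a ℚ.≤ b → 0ℚ ℚ.≤ b ℚ.- a
≤⇒0≤difference {a} {b} a≤b =
  ≤-from-difference a≤b (solve 2 (λ a b → b :- a := (b :- a) :- con 0ℚ) refl a b)

no-gap : ∀ {a b δ} → 0ℚ ℚ.< δ → a ℚ.+ δ ℚ.≤ b → ¬ (b ℚ.≤ a)
no-gap {a} {b} {δ} 0<δ a+δ≤b b≤a = ℚ.<-irrefl refl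
  (ℚ.<-≤-trans 0<δ (≤-from-difference (ℚ.≤-trans a+δ≤b b≤a)
    (solve 2 (λ a δ → a :- (a :+ δ) := con 0ℚ :- δ) refl a δ)))

*-monoˡ : ∀ {c a b} → 0ℚ ℚ.≤ c → a ℚ.≤ b → c ℚ.* a ℚ.≤ c ℚ.* b
*-monoˡ {c} 0≤c = ℚ.*-monoˡ-≤-nonNeg c {{ℚ.nonNegative 0≤c}}

*-monoʳ : ∀ {c a b} → 0ℚ ℚ.≤ c → a ℚ.≤ b → a ℚ.* c ℚ.≤ b ℚ.* c
*-monoʳ {c} 0≤c = ℚ.*-monoʳ-≤-nonNeg c {{ℚ.nonNegative 0≤c}}

0≤* : ∀ {a b} → 0ℚ ℚ.≤ a → 0ℚ ℚ.≤ b → 0ℚ ℚ.≤ a ℚ.* b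
0≤* {a} {b} 0≤a 0≤b = subst (ℚ._≤ a ℚ.* b) (ℚ.*-zeroʳ a) (*-monoˡ 0≤a 0≤b)

0<* : ∀ {a b} → 0ℚ ℚ.< a → 0ℚ ℚ.< b → 0ℚ ℚ.< a ℚ.* b
0<* {a} {b} 0<a 0<b = ℚ.positive⁻¹ (a ℚ.* b)
  {{ℚ.pos*pos⇒pos a {{ℚ.positive 0<a}} b {{ℚ.positive 0<b}}}}

p≤∣p∣ : ∀ p → p ℚ.≤ ℚ.∣ p ∣
p≤∣p∣ p with ℚ.∣p∣≡p∨∣p∣≡-p p
... | inj₁ e = ℚ.≤-reflexive (sym e)
... | inj₂ e = ℚ.≤-trans p≤0 (ℚ.0≤∣p∣ p)
  where
  p≤0 : p ℚ.≤ 0ℚ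
  p≤0 = ≤-from-difference (subst (0ℚ ℚ.≤_) e (ℚ.0≤∣p∣ p))
    (solve 1 (λ p → :- p :- con 0ℚ := con 0ℚ :- p) refl p)

-p≤∣p∣ : ∀ p → ℚ.- p ℚ.≤ ℚ.∣ p ∣
-p≤∣p∣ p = subst (ℚ.- p ℚ.≤_) (ℚ.∣-p∣≡∣p∣ p) (p≤∣p∣ (ℚ.- p))

a-b≤∣a-b∣ : ∀ a b → a ℚ.- b ℚ.≤ ℚ.∣ a ℚ.- b ∣
a-b≤∣a-b∣ a b = p≤∣p∣ (a ℚ.- b)

b-a≤∣a-b∣ : ∀ a b → b ℚ.- a ℚ.≤ ℚ.∣ a ℚ.- b ∣
b-a≤∣a-b∣ a b = subst (ℚ._≤ ℚ.∣ a ℚ.- b ∣)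
  (solve 2 (λ a b → :- (a :- b) := b :- a) refl a b) (-p≤∣p∣ (a ℚ.- b))

a≤b⇒∣a-b∣≡b-a : ∀ {a b} → a ℚ.≤ b → ℚ.∣ a ℚ.- b ∣ ≡ b ℚ.- a
a≤b⇒∣a-b∣≡b-a {a} {b} a≤b = trans (sym (ℚ.∣-p∣≡∣p∣ (a ℚ.- b)))
  (trans (cong ℚ.∣_∣ (solve 2 (λ a b → :- (a :- b) := b :- a) refl a b))
    (ℚ.0≤p⇒∣p∣≡p (≤⇒0≤difference a≤b)))

b≤a⇒∣a-b∣≡a-b : ∀ {a b} → b ℚ.≤ a → ℚ.∣ a ℚ.- b ∣ ≡ a ℚ.- b
b≤a⇒∣a-b∣≡a-b b≤a = ℚ.0≤p⇒∣p∣≡p (≤⇒0≤difference b≤a)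

-- Sums over an initial segment of times

prefix : ∀ {k} → (Fin k → ℚ) → ℕ → ℚ
prefix {zero}  f j       = 0ℚ
prefix {suc k} f zero    = 0ℚ
prefix {suc k} f (suc j) = f zero ℚ.+ prefix (f ∘ suc) j

prefix-zero : ∀ {k} (f : Fin k → ℚ) → prefix f 0 ≡ 0ℚ
prefix-zero {zero}  f = refl
prefix-zero {suc k} f = refl

prefix-cong : ∀ {k} {f g : Fin k → ℚ} j → (∀ s → toℕ s ℕ.< j → f s ≡ g s) →
  prefix f j ≡ prefix g j
prefix-cong {zero}  j       eq = refl
prefix-cong {suc k} zero    eq = refl
prefix-cong {suc k} (suc j) eq =
  cong₂ ℚ._+_ (eq zero (s≤s z≤n)) (prefix-cong j λ s s<j → eq (suc s) (s≤s s<j))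

prefix-suc : ∀ {k} (f : Fin k → ℚ) t → prefix f (suc (toℕ t)) ≡ prefix f (toℕ t) ℚ.+ f t
prefix-suc f zero    = trans (cong (f zero ℚ.+_) (prefix-zero (f ∘ suc)))
  (trans (ℚ.+-identityʳ (f zero)) (sym (ℚ.+-identityˡ (f zero))))
prefix-suc f (suc t) = trans (cong (f zero ℚ.+_) (prefix-suc (f ∘ suc) t))
  (sym (ℚ.+-assoc (f zero) (prefix (f ∘ suc) (toℕ t)) (f (suc t))))

sum-nonneg : ∀ {k} {f : Fin k → ℚ} → (∀ s → 0ℚ ℚ.≤ f s) → 0ℚ ℚ.≤ sum f
sum-nonneg {zero}  0≤f = ℚ.≤-refl
sum-nonneg {suc k} 0≤f = ℚ.+-mono-≤ (0≤f zero) (sum-nonneg (0≤f ∘ suc))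

sum-mono : ∀ {k} {f g : Fin k → ℚ} → (∀ s → f s ℚ.≤ g s) → sum f ℚ.≤ sum g
sum-mono {zero}  f≤g = ℚ.≤-refl
sum-mono {suc k} f≤g = ℚ.+-mono-≤ (f≤g zero) (sum-mono (f≤g ∘ suc))

sum-zero : ∀ {k} {f : Fin k → ℚ} → (∀ s → f s ≡ 0ℚ) → sum f ≡ 0ℚ
sum-zero {zero}  f≡0 = refl
sum-zero {suc k} f≡0 = cong₂ ℚ._+_ (f≡0 zero) (sum-zero (f≡0 ∘ suc))

sum≡prefix : ∀ {k} (f : Fin k → ℚ) j → (∀ s → j ℕ.≤ toℕ s → f s ≡ 0ℚ) → sum f ≡ prefix f j
sum≡prefix {zero}  f j       f≡0 = refl
sum≡prefix {suc k} f zero    f≡0 = sum-zero λ s → f≡0 s z≤n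
sum≡prefix {suc k} f (suc j) f≡0 =
  cong (f zero ℚ.+_) (sum≡prefix (f ∘ suc) j λ s j≤s → f≡0 (suc s) (s≤s j≤s))

term≤sum : ∀ {k} {f : Fin k → ℚ} → (∀ s → 0ℚ ℚ.≤ f s) → ∀ z → f z ℚ.≤ sum f
term≤sum {f = f} 0≤f zero = subst (ℚ._≤ sum f) (ℚ.+-identityʳ (f zero))
  (ℚ.+-monoʳ-≤ (f zero) (sum-nonneg (0≤f ∘ suc)))
term≤sum {f = f} 0≤f (suc z) = subst (ℚ._≤ sum f) (ℚ.+-identityˡ (f (suc z)))
  (ℚ.+-mono-≤ (0≤f zero) (term≤sum (0≤f ∘ suc) z))

prefix+term≤sum : ∀ {k} {f : Fin k → ℚ} → (∀ s → 0ℚ ℚ.≤ f s) →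
  ∀ j z → j ℕ.≤ toℕ z → prefix f j ℚ.+ f z ℚ.≤ sum f
prefix+term≤sum {f = f} 0≤f zero z j≤z = subst (ℚ._≤ sum f)
  (trans (sym (ℚ.+-identityˡ (f z))) (cong (ℚ._+ f z) (sym (prefix-zero f)))) (term≤sum 0≤f z)
prefix+term≤sum {f = f} 0≤f (suc j) (suc z) (s≤s j≤z) =
  subst (ℚ._≤ sum f) (sym (ℚ.+-assoc (f zero) (prefix (f ∘ suc) j) (f (suc z))))
    (ℚ.+-monoʳ-≤ (f zero) (prefix+term≤sum (0≤f ∘ suc) j z j≤z))

-- Going from r₀ to h and on to l costs at least (h − r₀) + (h − l).
tour-length : ∀ {k} (r l : Fin (suc k) → ℚ) t →
  (∀ i → suc i Fin.≤ t → r (suc i) ≡ l (inject₁ i)) →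
  ∀ h → h ≡ r zero ⊎ (∃ λ s → s Fin.≤ t × h ≡ l s) →
  (h ℚ.+ h) ℚ.- r zero ℚ.- l t ℚ.≤ prefix (λ s → ℚ.∣ r s ℚ.- l s ∣) (suc (toℕ t))
tour-length {k} r l zero follow h visit = ℚ.≤-trans (go visit)
  (ℚ.≤-reflexive (sym (trans
    (cong (∣r-l∣ zero ℚ.+_) (prefix-zero (∣r-l∣ ∘ suc))) (ℚ.+-identityʳ (∣r-l∣ zero)))))
  where
  ∣r-l∣ : Fin _ → ℚ
  ∣r-l∣ s = ℚ.∣ r s ℚ.- l s ∣

  go : h ≡ r zero ⊎ (∃ λ s → s Fin.≤ zero {k} × h ≡ l s) →
    (h ℚ.+ h) ℚ.- r zero ℚ.- l zero ℚ.≤ ∣r-l∣ zero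
  go (inj₁ refl) = subst (ℚ._≤ ∣r-l∣ zero)
    (solve 2 (λ r l → r :- l := (r :+ r) :- r :- l) refl (r zero) (l zero))
    (a-b≤∣a-b∣ (r zero) (l zero))
  go (inj₂ (zero , _ , refl)) = subst (ℚ._≤ ∣r-l∣ zero)
    (solve 2 (λ r l → l :- r := (l :+ l) :- r :- l) refl (r zero) (l zero))
    (b-a≤∣a-b∣ (r zero) (l zero))
tour-length {suc k} r l (suc t) follow h visit = go visit
  where
  ∣r-l∣ : Fin _ → ℚ
  ∣r-l∣ s = ℚ.∣ r s ℚ.- l s ∣

  rest : ℚ
  rest = prefix (∣r-l∣ ∘ suc) (suc (toℕ t))

  Onward : ℚ → Set
  Onward h = h ≡ l zero ⊎ (∃ λ s → s Fin.≤ t × h ≡ l (suc s))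

  rest-length : ∀ h → Onward h → (h ℚ.+ h) ℚ.- l zero ℚ.- l (suc t) ℚ.≤ rest
  rest-length h onward = subst (λ x → (h ℚ.+ h) ℚ.- x ℚ.- l (suc t) ℚ.≤ rest) r₁≡l₀
    (tour-length (r ∘ suc) (l ∘ suc) t (λ i i≤t → follow (suc i) (s≤s i≤t)) h
      (subst (λ x → h ≡ x ⊎ (∃ λ s → s Fin.≤ t × h ≡ l (suc s))) (sym r₁≡l₀) onward))
    where
    r₁≡l₀ : r (suc zero) ≡ l zero
    r₁≡l₀ = follow zero (s≤s z≤n)

  onward-length : ∀ h → Onward h → (h ℚ.+ h) ℚ.- r zero ℚ.- l (suc t) ℚ.≤ ∣r-l∣ zero ℚ.+ rest
  onward-length h onward = subst (ℚ._≤ ∣r-l∣ zero ℚ.+ rest)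
    (solve 4 (λ h r l m → (l :- r) :+ ((h :+ h) :- l :- m) := (h :+ h) :- r :- m) refl
      h (r zero) (l zero) (l (suc t)))
    (ℚ.+-mono-≤ (b-a≤∣a-b∣ (r zero) (l zero)) (rest-length h onward))

  go : h ≡ r zero ⊎ (∃ λ s → s Fin.≤ suc t × h ≡ l s) →
    (h ℚ.+ h) ℚ.- r zero ℚ.- l (suc t) ℚ.≤ ∣r-l∣ zero ℚ.+ rest
  -- With the peak at the start, the first request pays for the descent to `l zero`, and the rest is
  -- measured with `l zero` as its own peak.
  go (inj₁ refl) = subst (ℚ._≤ ∣r-l∣ zero ℚ.+ rest)
    (solve 3 (λ r l m → (r :- l) :+ ((l :+ l) :- l :- m) := (r :+ r) :- r :- m) refl
      (r zero) (l zero) (l (suc t)))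
    (ℚ.+-mono-≤ (a-b≤∣a-b∣ (r zero) (l zero)) (rest-length (l zero) (inj₁ refl)))
  go (inj₂ (zero , _ , refl))        = onward-length (l zero) (inj₁ refl)
  go (inj₂ (suc s , s≤s s≤t , refl)) = onward-length (l (suc s)) (inj₂ (s , s≤t , refl))

-- Permutations

transpose-first : ∀ {k} (i j : Fin k) → Components.transpose i j i ≡ j
transpose-first i j rewrite dec-true (i Fin.≟ i) refl = refl

transpose-other : ∀ {k} {i j s : Fin k} → s ≢ i → s ≢ j → Components.transpose i j s ≡ s
transpose-other {i = i} {j} {s} s≢i s≢j
  rewrite dec-false (s Fin.≟ i) s≢i | dec-false (s Fin.≟ j) s≢j = refl

-- Pigeonhole: if some `y` were missed, deleting it from the codomain would inject `Fin (suc k)`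
-- into `Fin k`.
injective⇒permutation : ∀ {k} (f : Fin k → Fin k) → (∀ {i j} → f i ≡ f j → i ≡ j) →
  ∃ λ (π : Permutation′ k) → ∀ i → π ⟨$⟩ʳ i ≡ f i
injective⇒permutation {zero}  f inj = permutation f f (λ ()) (λ ()) , λ _ → refl
injective⇒permutation {suc k} f inj =
  permutation f f⁻¹ (proj₂ ∘ onto) (λ i → inj (proj₂ (onto (f i)))) , λ _ → refl
  where
  onto : ∀ y → ∃ λ x → f x ≡ y
  onto y with Fin.any? (λ x → f x Fin.≟ y)
  ... | yes hit = hit
  ... | no miss = contradiction
    (Fin.injective⇒≤ {f = λ x → Fin.punchOut (avoids x)}
      λ {i} {j} eq → inj (Fin.punchOut-injective (avoids i) (avoids j) eq)) ℕ.1+n≰n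
    where
    avoids : ∀ x → y ≢ f x
    avoids x y≡fx = miss (x , sym y≡fx)
  f⁻¹ : Fin (suc k) → Fin (suc k)
  f⁻¹ = proj₁ ∘ onto

-- Instances with rational coordinates

seq-∑ : ∀ {k} (f : Fin k → ℝ) m → seq (∑ f) m ≡ sum (λ i → seq (f i) m)
seq-∑ {zero}  f m = refl
seq-∑ {suc k} f m = cong (seq (f zero) m ℚ.+_) (seq-∑ (f ∘ suc) m)

module _ {k} (pos req : Fin k → ℚ) where

  rational : (Fin k → Fin k) → Instance k
  rational pred = mkInstance (fromℚ ∘ pos) (λ t → arrival (fromℚ (req t)) (pred t))

  length : (Fin k → Fin k) → ℚ
  length f = sum λ t → ℚ.∣ req t ℚ.- pos (f t) ∣

  seq-costOf : ∀ pred f m → seq (costOf (rational pred) f) m ≡ length f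
  seq-costOf pred f m = seq-∑ (λ t → ∣ fromℚ (req t) - fromℚ (pos (f t)) ∣) m

  -- Linear programming duality: φ is the Kantorovich potential certifying optimality.
  optimal : ∀ pred (M : Permutation′ k) (φ : ℚ → ℚ) →
    (∀ a b → φ a ℚ.- φ b ℚ.≤ ℚ.∣ a ℚ.- b ∣) →
    (∀ t → ℚ.∣ req t ℚ.- pos (M ⟨$⟩ʳ t) ∣ ≡ φ (req t) ℚ.- φ (pos (M ⟨$⟩ʳ t))) →
    IsOptimal (rational pred) M
  optimal pred M φ φ-lip tight M′ (δ , 0<δ , N , h) = no-gap 0<δ
    (subst₂ (λ a b → a ℚ.+ δ ℚ.≤ b)
      (seq-costOf pred (M′ ⟨$⟩ʳ_) N) (seq-costOf pred (M ⟨$⟩ʳ_) N) (h N ℕ.≤-refl))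
    (ℚ.≤-trans
      (ℚ.≤-reflexive (trans (sum-cong-≗ tight) (trans (dual-const M) (sym (dual-const M′)))))
      (sum-mono λ t → φ-lip (req t) (pos (M′ ⟨$⟩ʳ t))))
    where
    dual : Permutation′ k → ℚ
    dual π = sum λ t → φ (req t) ℚ.- φ (pos (π ⟨$⟩ʳ t))

    -- A permutation only reorders the servers, so all matchings share one dual value.
    dual-const : ∀ π → dual π ≡ sum (φ ∘ req) ℚ.+ sum (λ t → ℚ.- φ (pos t))
    dual-const π = trans
      (∑-distrib-+ (φ ∘ req) (λ t → ℚ.- φ (pos (π ⟨$⟩ʳ t))))
      (cong (sum (φ ∘ req) ℚ.+_) (sym (sum-permute (λ t → ℚ.- φ (pos t)) π)))

  optimal⇒IsOPT : ∀ pred M {v} → IsOptimal (rational pred) M → length (M ⟨$⟩ʳ_) ≡ v →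
    IsOPT (rational pred) (fromℚ v)
  optimal⇒IsOPT pred M {v} opt eq = M , opt , λ δ 0<δ → 0 , λ n _ →
    subst (λ x → ℚ.∣ v ℚ.- x ∣ ℚ.< δ) (sym (trans (seq-costOf pred (M ⟨$⟩ʳ_) n) eq))
      (subst (ℚ._< δ) (sym (cong ℚ.∣_∣ (ℚ.+-inverseʳ v))) 0<δ)

  -- As `_≤_` is a negated strict inequality, one rational gap `g` on a tail of `x` refutes it; the
  -- cost itself is a constant sequence.
  cost-exceeds : ∀ pred (A : Algorithm k) x v {g} → 0ℚ ℚ.< g →
    (∃ λ N → ∀ n → N ℕ.≤ n → seq x n ℚ.* v ℚ.+ g ℚ.≤ length (run A (rational pred))) →
    ¬ (cost A (rational pred) ≤ x * fromℚ v)
  cost-exceeds pred A x v {g} 0<g (N , bound) cost≤ = cost≤ (g , 0<g , N , λ n N≤n →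
    subst (seq x n ℚ.* v ℚ.+ g ℚ.≤_) (sym (seq-costOf pred (run A (rational pred)) n)) (bound n N≤n))

-- The adversary

≈-refl : ∀ x → x ≈ x
≈-refl x δ 0<δ = 0 , λ n _ → subst (ℚ._< δ) (sym (cong ℚ.∣_∣ (ℚ.+-inverseʳ (seq x n)))) 0<δ

-- This makes an adaptive adversary possible: arrivals after `t` can be rewritten without disturbing
-- the choices made so far.
run-causal : ∀ {k} (A : Algorithm k) {s : Placement k} {a b : Fin k → Arrival k} t →
  (∀ i → i Fin.≤ t → a i ≡ b i) → run A (mkInstance s a) t ≡ run A (mkInstance s b) t
run-causal A {s} {a} {b} t agree = choose-cong A t (λ i → ≈-refl (s i))
  (λ i → same (agree (inject i)
    (ℕ.<⇒≤ (subst (ℕ._< toℕ t) (sym (Fin.toℕ-inject i)) (Fin.toℕ<n i)))))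
  (same (agree t ℕ.≤-refl))
  where
  same : ∀ {x y} → x ≡ y → x ≈ₐ y
  same {x} refl = mk≈ₐ (≈-refl (Arrival.request x)) refl

run-injective : ∀ {k} (A : Algorithm k) I {i j} → run A I i ≡ run A I j → i ≡ j
run-injective A I {i} {j} eq with Fin.<-cmp i j
... | tri< i<j _ _ = contradiction (sym eq) (free A I i<j)
... | tri≈ _ i≡j _ = i≡j
... | tri> _ _ j<i = contradiction eq (free A I j<i)

next-time : ∀ {k} {τ z : Fin k} → τ Fin.< z → ∃ λ τ⁺ → toℕ τ⁺ ≡ suc (toℕ τ)
next-time {z = z} τ<z = Fin.fromℕ< (ℕ.≤-<-trans τ<z (Fin.toℕ<n z)) , Fin.toℕ-fromℕ< _

least-failure : ∀ {m} {P : Fin m → Set} → (∀ i → Dec (P i)) → ¬ (∀ i → P i) →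
  ∃ λ i → ¬ P i × (∀ j → j Fin.< i → P j)
least-failure {m} {P} P? ¬∀ with Fin.¬∀⟶∃¬-smallest m P P? ¬∀
... | i , ¬Pi , P< = i , ¬Pi , λ j j<i → subst P
  (Fin.toℕ-injective (trans (Fin.toℕ-inject (Fin.fromℕ< j<i)) (Fin.toℕ-fromℕ< j<i)))
  (P< (Fin.fromℕ< j<i))

-- Horner form of 1 + c + ⋯ + c^m, in which `d c (suc m) - 1` is visibly `c * d c m`.
d : ℚ → ℕ → ℚ
d c zero    = 1ℚ
d c (suc m) = 1ℚ ℚ.+ c ℚ.* d c m

module Adversary {n} (A : Algorithm (suc (suc n))) (c : ℚ) (0≤c : 0ℚ ℚ.≤ c) where

  k : ℕ
  k = suc (suc n)

  -- The value `d c 0 = 1` is the place of the first request, not of a server; server 0 stands at 0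
  -- instead.
  pos : Fin k → ℚ
  pos zero    = 0ℚ
  pos (suc i) = d c (suc (toℕ i))

  1≤d : ∀ m → 1ℚ ℚ.≤ d c m
  1≤d zero    = ℚ.≤-refl
  1≤d (suc m) = subst (ℚ._≤ d c (suc m)) (ℚ.+-identityʳ 1ℚ)
    (ℚ.+-monoʳ-≤ 1ℚ (0≤* 0≤c (ℚ.≤-trans 0≤1 (1≤d m))))

  d-mono : ∀ {i j} → i ℕ.≤ j → d c i ℚ.≤ d c j
  d-mono {j = j} z≤n = 1≤d j
  d-mono (s≤s i≤j) = ℚ.+-monoʳ-≤ 1ℚ (*-monoˡ 0≤c (d-mono i≤j))

  0≤pos : ∀ i → 0ℚ ℚ.≤ pos i
  0≤pos zero    = ℚ.≤-refl
  0≤pos (suc i) = ℚ.≤-trans 0≤1 (1≤d (suc (toℕ i)))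

  -- The play up to the arrival of request τ: request 0 is at 1 and each later one
  -- is at the server used just before.  The predictions M send everything served
  -- so far to a used server, except that the nearest unused server other than 0,
  -- with label suc u, is predicted too.  Requests after τ, which are provisional,
  -- sit on their predicted servers.
  record Stage (τ : Fin k) : Set where
    field
      req : Fin k → ℚ
      M   : Permutation′ k
      u   : Fin (suc n)

    played : Instance k
    played = rational pos req (M ⟨$⟩ʳ_)

    w : Fin k → Fin k
    w = run A played

    field
      moves  : ∀ {s} → s Fin.< τ → w s ≢ zero
      fresh  : ∀ {s} → s Fin.< τ → w s ≢ suc u
      lower  : ∀ v → v Fin.< u → ∃ λ s → s Fin.< τ × w s ≡ suc v
      guided : ∀ {s} → s Fin.≤ τ → M ⟨$⟩ʳ s ≡ suc u ⊎ ∃ λ s′ → s′ Fin.< τ × M ⟨$⟩ʳ s ≡ w s′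
      start  : req zero ≡ 1ℚ
      follow : ∀ i → suc i Fin.≤ τ → req (suc i) ≡ pos (w (inject₁ i))
      future : ∀ s → τ Fin.< s → req s ≡ pos (M ⟨$⟩ʳ s)
      below  : ∀ s → req s ℚ.≤ pos (M ⟨$⟩ʳ s)
      value  : prefix (λ s → pos (M ⟨$⟩ʳ s) ℚ.- req s) (suc (toℕ τ)) ≡ pos (suc u) ℚ.- 1ℚ

    moves-until : w τ ≢ zero → ∀ {s} → s Fin.≤ τ → w s ≢ zero
    moves-until moved s≤τ with ℕ.m≤n⇒m<n∨m≡n s≤τ
    ... | inj₁ s<τ = moves s<τ
    ... | inj₂ eq  = subst (λ x → w x ≢ zero) (sym (Fin.toℕ-injective eq)) moved

    -- By `guided`, requests up to `τ` are predicted only to `suc u` or to used servers, so `M` must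
    -- keep any other server for later.
    unguided : ∀ {v} → v ≢ suc u → (∀ {s} → s Fin.< τ → w s ≢ v) → τ Fin.< M ⟨$⟩ˡ v
    unguided {v} v≢u unused = ℕ.≰⇒> λ early → go early (guided early)
      where
      go : M ⟨$⟩ˡ v Fin.≤ τ → _ → _
      go _ (inj₁ eq)              = v≢u (trans (sym (inverseʳ M)) eq)
      go _ (inj₂ (s′ , s′<τ , eq)) = unused s′<τ (trans (sym eq) (inverseʳ M))

    -- Hence each stage already holds a later request at 0, ready to punish a return to server 0.
    zero-later : τ Fin.< M ⟨$⟩ˡ zero
    zero-later = unguided (λ ()) moves

    ∣req-pos∣ : ∀ t → ℚ.∣ req t ℚ.- pos (M ⟨$⟩ʳ t) ∣ ≡ pos (M ⟨$⟩ʳ t) ℚ.- req t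
    ∣req-pos∣ t = a≤b⇒∣a-b∣≡b-a (below t)

    -- No request lies to the right of its server, so the potential x ↦ -x is tight on every pair.
    M-optimal : IsOptimal (rational pos req (M ⟨$⟩ʳ_)) M
    M-optimal = optimal pos req (M ⟨$⟩ʳ_) M ℚ.-_
      (λ a b → subst (ℚ._≤ ℚ.∣ a ℚ.- b ∣) (flip a b) (b-a≤∣a-b∣ a b))
      (λ t → trans (∣req-pos∣ t) (flip (req t) (pos (M ⟨$⟩ʳ t))))
      where
      flip : ∀ a b → b ℚ.- a ≡ (ℚ.- a) ℚ.- (ℚ.- b)
      flip = solve 2 (λ a b → b :- a := (:- a) :- (:- b)) refl

    M-length : length pos req (M ⟨$⟩ʳ_) ≡ c ℚ.* d c (toℕ u)
    M-length = begin
      length pos req (M ⟨$⟩ʳ_)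
        ≡⟨ sum-cong-≗ ∣req-pos∣ ⟩
      sum (λ s → pos (M ⟨$⟩ʳ s) ℚ.- req s)
        ≡⟨ sum≡prefix _ (suc (toℕ τ)) (λ s τ<s → trans
             (cong (λ x → pos (M ⟨$⟩ʳ s) ℚ.- x) (future s τ<s)) (ℚ.+-inverseʳ (pos (M ⟨$⟩ʳ s)))) ⟩
      prefix (λ s → pos (M ⟨$⟩ʳ s) ℚ.- req s) (suc (toℕ τ))
        ≡⟨ value ⟩
      (1ℚ ℚ.+ c ℚ.* d c (toℕ u)) ℚ.- 1ℚ
        ≡⟨ solve 1 (λ x → (con 1ℚ :+ x) :- con 1ℚ := x) refl (c ℚ.* d c (toℕ u)) ⟩
      c ℚ.* d c (toℕ u) ∎
      where open ≡-Reasoning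

    tour : ∀ {h} → h ≡ 1ℚ ⊎ (∃ λ s → s Fin.≤ τ × h ≡ pos (w s)) →
      (h ℚ.+ h) ℚ.- 1ℚ ℚ.- pos (w τ) ℚ.≤
        prefix (λ s → ℚ.∣ req s ℚ.- pos (w s) ∣) (suc (toℕ τ))
    tour {h} = subst (λ x → h ≡ x ⊎ (∃ λ s → s Fin.≤ τ × h ≡ pos (w s)) →
        (h ℚ.+ h) ℚ.- x ℚ.- pos (w τ) ℚ.≤ path) start
      (tour-length req (pos ∘ w) τ follow h)
      where
      path : ℚ
      path = prefix (λ s → ℚ.∣ req s ℚ.- pos (w s) ∣) (suc (toℕ τ))

    -- With `D = d c (toℕ u)`, the walk from 1 up to `D` and back to 0 costs at least 2D - 1. The
    -- later request at 0 finds the servers below `suc u` taken and pays at least 1 + cD.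
    deviation-cost : w τ ≡ zero →
      (d c (toℕ u) ℚ.+ d c (toℕ u)) ℚ.+ c ℚ.* d c (toℕ u) ℚ.≤ length pos req w
    deviation-cost wτ≡0 = ℚ.≤-trans
      (≤-from-difference (ℚ.+-mono-≤ (tour (reached u refl)) zero-cost) (trans
        (cong (λ x → (path ℚ.+ last) ℚ.- (((D ℚ.+ D) ℚ.- 1ℚ ℚ.- pos x) ℚ.+ (1ℚ ℚ.+ c ℚ.* D))) wτ≡0)
        (solve 3 (λ p D e → p :- (((D :+ D) :- con 1ℚ :- con 0ℚ) :+ (con 1ℚ :+ e)) :=
          p :- ((D :+ D) :+ e)) refl (path ℚ.+ last) D (c ℚ.* D))))
      (prefix+term≤sum (λ s → ℚ.0≤∣p∣ (req s ℚ.- pos (w s))) (suc (toℕ τ)) z zero-later)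
      where
      D = d c (toℕ u)
      z = M ⟨$⟩ˡ zero
      path = prefix (λ s → ℚ.∣ req s ℚ.- pos (w s) ∣) (suc (toℕ τ))
      last = ℚ.∣ req z ℚ.- pos (w z) ∣

      -- For `u = zero` the peak `D` is the first request itself; otherwise it is the server just
      -- below `suc u`, which `lower` says is used.
      reached : ∀ v → v ≡ u → d c (toℕ v) ≡ 1ℚ ⊎ (∃ λ s → s Fin.≤ τ × d c (toℕ v) ≡ pos (w s))
      reached zero    _    = inj₁ refl
      reached (suc v) v≡u with lower (inject₁ v)
        (subst (inject₁ v Fin.<_) v≡u (ℕ.≤-reflexive (cong suc (Fin.toℕ-inject₁ v))))
      ... | s , s<τ , ws = inj₂ (s , ℕ.<⇒≤ s<τ , trans
        (cong (λ m → d c (suc m)) (sym (Fin.toℕ-inject₁ v))) (sym (cong pos ws)))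

      far : ∀ y → y ≡ w z → pos (suc u) ℚ.≤ pos y
      far zero    eq = contradiction (trans (sym eq) (sym wτ≡0)) (free A played zero-later)
      far (suc v) eq with v Fin.<? u
      ... | no v≮u  = d-mono (s≤s (ℕ.≮⇒≥ v≮u))
      ... | yes v<u with lower v v<u
      ...   | s , s<τ , ws =
        contradiction (trans (sym eq) (sym ws)) (free A played (ℕ.<-trans s<τ zero-later))

      zero-cost : pos (suc u) ℚ.≤ last
      zero-cost = ℚ.≤-trans (far (w z) refl) (≤-from-difference (b-a≤∣a-b∣ (req z) (pos (w z)))
        (trans (cong (λ x → last ℚ.- (pos (w z) ℚ.- x))
            (trans (future z zero-later) (cong pos (inverseʳ M))))
          (solve 2 (λ l p → l :- (p :- con 0ℚ) := l :- p) refl last (pos (w z)))))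

  -- Extending the play by one request

  open Stage

  initial : Stage zero
  initial = record
    { req = r ; M = π ; u = zero
    ; moves = λ () ; fresh = λ () ; lower = λ _ ()
    ; guided = λ { {zero} _ → inj₁ refl }
    ; start = refl ; follow = λ _ ()
    ; future = λ { (suc s) _ → refl }
    ; below = λ { zero → 1≤d 1 ; (suc s) → ℚ.≤-refl }
    ; value = ℚ.+-identityʳ _
    }
    where
    π : Permutation′ k
    -- Request 0 is predicted to server 1, and request 1 provisionally takes over server 0.
    π = transpose zero (suc zero)
    r : Fin k → ℚ
    r zero    = 1ℚ
    r (suc s) = pos (π ⟨$⟩ʳ suc s)

  module Next {τ τ⁺ : Fin k} (S : Stage τ) (τ⁺≡ : toℕ τ⁺ ≡ suc (toℕ τ))
    (v : Fin k) (u′ : Fin (suc n))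
    (moved   : w S τ ≢ zero)
    (v-later : τ Fin.< M S ⟨$⟩ˡ v)
    (fresh′  : ∀ {s} → s Fin.≤ τ → w S s ≢ suc u′)
    (lower′  : ∀ y → y Fin.< u′ → ∃ λ s → s Fin.≤ τ × w S s ≡ suc y)
    (old     : suc (u S) ≡ suc u′ ⊎ suc (u S) ≡ w S τ)
    (new     : v ≡ suc u′ ⊎ v ≡ w S τ)
    (ahead   : pos (w S τ) ℚ.≤ pos v)
    (shift   : pos v ℚ.- pos (w S τ) ≡ pos (suc u′) ℚ.- pos (suc (u S)))
    where

    -- Both swapped times lie after `τ`, so the predictions already shown stay as they are.
    M′ : Permutation′ k
    M′ = transpose τ⁺ (M S ⟨$⟩ˡ v) ∘ₚ M S

    M′-now : M′ ⟨$⟩ʳ τ⁺ ≡ v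
    M′-now = trans (cong (M S ⟨$⟩ʳ_) (transpose-first τ⁺ (M S ⟨$⟩ˡ v))) (inverseʳ (M S))

    τ<τ⁺ : τ Fin.< τ⁺
    τ<τ⁺ = ℕ.≤-reflexive (sym τ⁺≡)

    ≤τ : ∀ {s : Fin k} → s Fin.< τ⁺ → s Fin.≤ τ
    ≤τ s<τ⁺ = ℕ.s≤s⁻¹ (subst (_ ℕ.≤_) τ⁺≡ s<τ⁺)

    <τ⁺ : ∀ {s : Fin k} → s Fin.≤ τ → s Fin.< τ⁺
    <τ⁺ s≤τ = ℕ.≤-<-trans s≤τ τ<τ⁺

    M′-old : ∀ {s} → s Fin.≤ τ → M′ ⟨$⟩ʳ s ≡ M S ⟨$⟩ʳ s
    M′-old s≤τ = cong (M S ⟨$⟩ʳ_) (transpose-other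
      (λ { refl → ℕ.<⇒≱ τ<τ⁺ s≤τ }) (λ { refl → ℕ.<⇒≱ v-later s≤τ }))

    req′ : Fin k → ℚ
    req′ s with Fin.<-cmp s τ⁺
    ... | tri< _ _ _ = req S s
    ... | tri≈ _ _ _ = pos (w S τ)
    ... | tri> _ _ _ = pos (M′ ⟨$⟩ʳ s)

    req′-old : ∀ {s} → s Fin.≤ τ → req′ s ≡ req S s
    req′-old {s} s≤τ with Fin.<-cmp s τ⁺
    ... | tri< _ _ _  = refl
    ... | tri≈ ≮ _ _  = contradiction (<τ⁺ s≤τ) ≮
    ... | tri> ≮ _ _  = contradiction (<τ⁺ s≤τ) ≮

    req′-now : req′ τ⁺ ≡ pos (w S τ)
    req′-now with Fin.<-cmp τ⁺ τ⁺
    ... | tri< _ ≢ _ = contradiction refl ≢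
    ... | tri≈ _ _ _ = refl
    ... | tri> _ ≢ _ = contradiction refl ≢

    req′-later : ∀ s → τ⁺ Fin.< s → req′ s ≡ pos (M′ ⟨$⟩ʳ s)
    req′-later s τ⁺<s with Fin.<-cmp s τ⁺
    ... | tri< _ _ ≯ = contradiction τ⁺<s ≯
    ... | tri≈ _ _ ≯ = contradiction τ⁺<s ≯
    ... | tri> _ _ _ = refl

    w′ : Fin k → Fin k
    w′ = run A (rational pos req′ (M′ ⟨$⟩ʳ_))

    w′-old : ∀ {s} → s Fin.≤ τ → w′ s ≡ w S s
    w′-old s≤τ = run-causal A {fromℚ ∘ pos} _ λ i i≤s → let i≤τ = ℕ.≤-trans i≤s s≤τ in
      cong₂ (λ x y → arrival (fromℚ x) y) (req′-old i≤τ) (M′-old i≤τ)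

    split : ∀ (s : Fin k) → s Fin.≤ τ⁺ → s Fin.≤ τ ⊎ s ≡ τ⁺
    split s s≤τ⁺ with ℕ.m≤n⇒m<n∨m≡n s≤τ⁺
    ... | inj₁ s<τ⁺ = inj₁ (≤τ s<τ⁺)
    ... | inj₂ eq   = inj₂ (Fin.toℕ-injective eq)

    Guided : Fin k → Set
    Guided x = x ≡ suc u′ ⊎ ∃ λ s′ → s′ Fin.< τ⁺ × x ≡ w′ s′

    used-now : ∀ {x} → x ≡ suc u′ ⊎ x ≡ w S τ → Guided x
    used-now (inj₁ eq) = inj₁ eq
    used-now (inj₂ eq) = inj₂ (τ , τ<τ⁺ , trans eq (sym (w′-old ℕ.≤-refl)))

    guided′ : ∀ {s} → s Fin.≤ τ⁺ → Guided (M′ ⟨$⟩ʳ s)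
    guided′ {s} s≤τ⁺ with split s s≤τ⁺
    ... | inj₂ refl = subst Guided (sym M′-now) (used-now new)
    ... | inj₁ s≤τ with guided S s≤τ
    ...   | inj₁ eq = subst Guided (sym (trans (M′-old s≤τ) eq)) (used-now old)
    ...   | inj₂ (s′ , s′<τ , eq) = inj₂
      (s′ , <τ⁺ (ℕ.<⇒≤ s′<τ) , trans (M′-old s≤τ) (trans eq (sym (w′-old (ℕ.<⇒≤ s′<τ)))))

    follow″ : ∀ i → suc i Fin.≤ τ ⊎ suc i ≡ τ⁺ → req′ (suc i) ≡ pos (w′ (inject₁ i))
    follow″ i (inj₁ i<τ) = trans (req′-old i<τ) (trans (follow S i i<τ)
      (cong pos (sym (w′-old (ℕ.≤-trans (ℕ.≤-reflexive (Fin.toℕ-inject₁ i)) (ℕ.<⇒≤ i<τ))))))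
    follow″ i (inj₂ refl) = trans req′-now (cong pos (trans (sym (w′-old ℕ.≤-refl))
      (cong w′ (Fin.toℕ-injective
        (trans (sym (ℕ.suc-injective τ⁺≡)) (sym (Fin.toℕ-inject₁ i)))))))

    below′ : ∀ s → req′ s ℚ.≤ pos (M′ ⟨$⟩ʳ s)
    below′ s with Fin.<-cmp s τ⁺
    ... | tri< s<τ⁺ _ _ =
      subst (λ x → req S s ℚ.≤ pos x) (sym (M′-old (≤τ s<τ⁺))) (below S s)
    ... | tri≈ _ refl _ = subst (λ x → pos (w S τ) ℚ.≤ pos x) (sym M′-now) ahead
    ... | tri> _ _ _    = ℚ.≤-refl

    value′ : prefix (λ s → pos (M′ ⟨$⟩ʳ s) ℚ.- req′ s) (suc (toℕ τ⁺)) ≡ pos (suc u′) ℚ.- 1ℚ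
    value′ = begin
      prefix f′ (suc (toℕ τ⁺))
        ≡⟨ prefix-suc f′ τ⁺ ⟩
      prefix f′ (toℕ τ⁺) ℚ.+ f′ τ⁺
        ≡⟨ cong₂ ℚ._+_
             (trans (cong (prefix f′) τ⁺≡) (trans (prefix-cong (suc (toℕ τ)) λ s s≤τ →
                cong₂ (λ x y → pos x ℚ.- y) (M′-old (ℕ.s≤s⁻¹ s≤τ)) (req′-old (ℕ.s≤s⁻¹ s≤τ)))
               (value S)))
             (trans (cong₂ (λ x y → pos x ℚ.- y) M′-now req′-now) shift) ⟩
      (pos (suc (u S)) ℚ.- 1ℚ) ℚ.+ (pos (suc u′) ℚ.- pos (suc (u S)))
        ≡⟨ solve 3 (λ a b e → (a :- e) :+ (b :- a) := b :- e) refl (pos (suc (u S))) (pos (suc u′)) 1ℚ ⟩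
      pos (suc u′) ℚ.- 1ℚ ∎
      where
      open ≡-Reasoning
      f′ : Fin k → ℚ
      f′ s = pos (M′ ⟨$⟩ʳ s) ℚ.- req′ s

    next : Stage τ⁺
    next = record
      { req = req′ ; M = M′ ; u = u′
      ; moves = λ s<τ⁺ → subst (_≢ zero) (sym (w′-old (≤τ s<τ⁺))) (moves-until S moved (≤τ s<τ⁺))
      ; fresh = λ s<τ⁺ → subst (_≢ suc u′) (sym (w′-old (≤τ s<τ⁺))) (fresh′ (≤τ s<τ⁺))
      ; lower = λ y y<u′ → let s , s≤τ , ws = lower′ y y<u′ in
          s , <τ⁺ s≤τ , trans (w′-old s≤τ) ws
      ; guided = guided′
      ; start = trans (req′-old z≤n) (start S)
      ; follow = λ i i≤τ⁺ → follow″ i (split (suc i) i≤τ⁺)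
      ; future = req′-later
      ; below = below′
      ; value = value′
      }

  -- With optimum 1, the cost of the algorithm is itself a lower bound on its robustness; `suc n` is
  -- k - 1.
  Outcome : Set
  Outcome = ∃ λ req → ∃ λ pred → ∃ λ π → IsOptimal (rational pos req pred) π ×
    length pos req (π ⟨$⟩ʳ_) ≡ 1ℚ ×
    (d c (suc n) ℚ.+ d c (suc n)) ℚ.- 1ℚ ℚ.≤ length pos req (run A (rational pos req pred))

  module Last {τ : Fin k} (S : Stage τ) (moved : w S τ ≢ zero)
    (all-used : ∀ y → ∃ λ s → s Fin.≤ τ × w S s ≡ suc y) where

    -- What remains after `τ` is moved onto the server just used, with the predictions unchanged.
    -- They need no longer be perfect, which robustness permits.
    req′ : Fin k → ℚ
    req′ s with s Fin.≤? τ
    ... | yes _ = req S s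
    ... | no  _ = pos (w S τ)

    req′-old : ∀ {s} → s Fin.≤ τ → req′ s ≡ req S s
    req′-old {s} s≤τ with s Fin.≤? τ
    ... | yes _  = refl
    ... | no s≰τ = contradiction s≤τ s≰τ

    req′-later : ∀ {s} → τ Fin.< s → req′ s ≡ pos (w S τ)
    req′-later {s} τ<s with s Fin.≤? τ
    ... | yes s≤τ = contradiction s≤τ (ℕ.<⇒≱ τ<s)
    ... | no _    = refl

    J : Instance k
    J = rational pos req′ (M S ⟨$⟩ʳ_)

    w′ : Fin k → Fin k
    w′ = run A J

    w′-old : ∀ {s} → s Fin.≤ τ → w′ s ≡ w S s
    w′-old s≤τ = run-causal A {fromℚ ∘ pos} _ λ i i≤s →
      cong (λ x → arrival (fromℚ x) (M S ⟨$⟩ʳ i)) (req′-old (ℕ.≤-trans i≤s s≤τ))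

    later-zero : ∀ {s} → τ Fin.< s → w′ s ≡ zero
    later-zero {s} τ<s = go (w′ s) refl
      where
      go : ∀ x → x ≡ w′ s → w′ s ≡ zero
      go zero    eq = sym eq
      go (suc y) eq with all-used y
      ... | s′ , s′≤τ , ws′ = contradiction
        (trans (sym eq) (trans (sym ws′) (sym (w′-old s′≤τ)))) (free A J (ℕ.≤-<-trans s′≤τ τ<s))

    inject₁<suc : ∀ (i : Fin (suc n)) → inject₁ i Fin.< suc i
    inject₁<suc i = ℕ.≤-reflexive (cong suc (Fin.toℕ-inject₁ i))

    -- Server 0 is used only once, so τ is the last time but one.
    inject₁≤τ : ∀ (i : Fin (suc n)) → inject₁ i Fin.≤ τ
    inject₁≤τ i = ℕ.≮⇒≥ λ τ<i → free A J (inject₁<suc i)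
      (trans (later-zero (ℕ.<-trans τ<i (inject₁<suc i))) (sym (later-zero τ<i)))

    shifted : Fin k → Fin k
    shifted zero    = zero
    shifted (suc i) = w′ (inject₁ i)

    nonzero : ∀ i → w′ (inject₁ i) ≢ zero
    nonzero i eq = moves-until S moved (inject₁≤τ i) (trans (sym (w′-old (inject₁≤τ i))) eq)

    shifted-injective : ∀ {i j} → shifted i ≡ shifted j → i ≡ j
    shifted-injective {zero}  {zero}  eq = refl
    shifted-injective {zero}  {suc j} eq = contradiction (sym eq) (nonzero j)
    shifted-injective {suc i} {zero}  eq = contradiction eq (nonzero i)
    shifted-injective {suc i} {suc j} eq = cong suc (Fin.inject₁-injective (run-injective A J eq))

    served : ∀ i → req′ (suc i) ≡ pos (w′ (inject₁ i))
    served i with suc i Fin.≤? τ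
    ... | yes i<τ = trans (follow S i i<τ) (cong pos (sym (w′-old (inject₁≤τ i))))
    -- Here `inject₁ i ≤ τ < suc i` forces `inject₁ i = τ`, and the last request was put on the
    -- server of `τ`.
    ... | no  i≮τ = cong pos (trans (cong (w S) (Fin.toℕ-injective (ℕ.≤-antisym
      (subst (toℕ τ ℕ.≤_) (sym (Fin.toℕ-inject₁ i)) (ℕ.s≤s⁻¹ (ℕ.≰⇒> i≮τ))) (inject₁≤τ i))))
      (sym (w′-old (inject₁≤τ i))))

    start′ : req′ zero ≡ 1ℚ
    start′ = trans (req′-old z≤n) (start S)

    π : Permutation′ k
    π = proj₁ (injective⇒permutation shifted shifted-injective)

    π≡ : ∀ i → π ⟨$⟩ʳ i ≡ shifted i
    π≡ = proj₂ (injective⇒permutation shifted shifted-injective)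

    shifted-below : ∀ t → pos (shifted t) ℚ.≤ req′ t
    shifted-below zero    = subst (0ℚ ℚ.≤_) (sym start′) 0≤1
    shifted-below (suc i) = ℚ.≤-reflexive (sym (served i))

    -- Now no request lies to the left of its server, so the identity is a tight potential.
    π-optimal : IsOptimal J π
    π-optimal = optimal pos req′ (M S ⟨$⟩ʳ_) π (λ x → x) a-b≤∣a-b∣ λ t →
      b≤a⇒∣a-b∣≡a-b (subst (λ x → pos x ℚ.≤ req′ t) (sym (π≡ t)) (shifted-below t))

    π-length : length pos req′ (π ⟨$⟩ʳ_) ≡ 1ℚ
    π-length = trans
      (sum-cong-≗ λ t → cong (λ x → ℚ.∣ req′ t ℚ.- pos x ∣) (π≡ t))
      (cong₂ ℚ._+_ (cong (λ x → ℚ.∣ x ℚ.- 0ℚ ∣) start′)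
        (sum-zero λ i → cong ℚ.∣_∣ (trans
          (cong (ℚ._- pos (w′ (inject₁ i))) (served i)) (ℚ.+-inverseʳ (pos (w′ (inject₁ i)))))))

    -- The walk passes the farthest server and stops at `pos (w S τ)`, costing at least twice the
    -- farthest distance minus 1 and minus `pos (w S τ)`; the last request, forced onto server 0,
    -- pays that final term back.
    end-cost : (d c (suc n) ℚ.+ d c (suc n)) ℚ.- 1ℚ ℚ.≤ length pos req′ w′
    end-cost = ℚ.≤-trans
      (≤-from-difference (ℚ.+-mono-≤ (tour S (inj₂ farthest)) back)
        (solve 4 (λ p l D a → (p :+ l) :- (((D :+ D) :- con 1ℚ :- a) :+ a) :=
          (p :+ l) :- ((D :+ D) :- con 1ℚ)) refl path last (d c (suc n)) (pos (w S τ))))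
      (subst (λ x → x ℚ.+ last ℚ.≤ length pos req′ w′) path≡
        (prefix+term≤sum (λ s → ℚ.0≤∣p∣ (req′ s ℚ.- pos (w′ s))) (suc (toℕ τ)) z (zero-later S)))
      where
      z = M S ⟨$⟩ˡ zero
      last = ℚ.∣ req′ z ℚ.- pos (w′ z) ∣
      path = prefix (λ s → ℚ.∣ req S s ℚ.- pos (w S s) ∣) (suc (toℕ τ))

      path≡ : prefix (λ s → ℚ.∣ req′ s ℚ.- pos (w′ s) ∣) (suc (toℕ τ)) ≡ path
      path≡ = prefix-cong (suc (toℕ τ)) λ s s≤τ →
        cong₂ (λ x y → ℚ.∣ x ℚ.- pos y ∣) (req′-old (ℕ.s≤s⁻¹ s≤τ)) (w′-old (ℕ.s≤s⁻¹ s≤τ))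

      farthest : ∃ λ s → s Fin.≤ τ × d c (suc n) ≡ pos (w S s)
      farthest with all-used (Fin.fromℕ n)
      ... | s , s≤τ , ws =
        s , s≤τ , trans (cong (d c ∘ suc) (sym (Fin.toℕ-fromℕ n))) (cong pos (sym ws))

      back : pos (w S τ) ℚ.≤ last
      back = subst (ℚ._≤ last)
        (trans (cong₂ (λ x y → x ℚ.- pos y) (req′-later (zero-later S)) (later-zero (zero-later S)))
          (ℚ.+-identityʳ (pos (w S τ))))
        (a-b≤∣a-b∣ (req′ z) (pos (w′ z)))

    outcome : Outcome
    outcome = req′ , (M S ⟨$⟩ʳ_) , π , π-optimal , π-length , end-cost

  -- The replies of the adversary and the end of the play

  step : ∀ {τ τ⁺} → toℕ τ⁺ ≡ suc (toℕ τ) → (S : Stage τ) → w S τ ≢ zero → Outcome ⊎ Stage τ⁺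
  step {τ} {τ⁺} τ⁺≡ S moved = go (w S τ) refl
    where
    Used : Fin (suc n) → Set
    Used y = ∃ λ s → s Fin.≤ τ × w S s ≡ suc y

    used? : ∀ y → Dec (Used y)
    used? y = Fin.any? λ s → s Fin.≤? τ ×-dec w S s Fin.≟ suc y

    go : ∀ x → w S τ ≡ x → Outcome ⊎ Stage τ⁺
    go zero    wτ = contradiction wτ moved
    go (suc x) wτ with x Fin.≟ u S
    -- The algorithm skipped `suc u`: the new request is predicted to the server it sits on, and the
    -- optimum does not change.
    ... | no x≢u = inj₂ (Next.next S τ⁺≡ (suc x) (u S) moved
      (unguided S (x≢u ∘ Fin.suc-injective)
        (λ s<τ ws → free A (played S) s<τ (trans wτ (sym ws))))
      unused (λ y y<u → let s , s<τ , ws = lower S y y<u in s , ℕ.<⇒≤ s<τ , ws)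
      (inj₁ refl) (inj₂ (sym wτ)) (ℚ.≤-reflexive (cong pos wτ))
      (trans (cong (λ y → pos (suc x) ℚ.- pos y) wτ)
        (trans (ℚ.+-inverseʳ (pos (suc x))) (sym (ℚ.+-inverseʳ (pos (suc (u S))))))))
      where
      unused : ∀ {s} → s Fin.≤ τ → w S s ≢ suc (u S)
      unused s≤τ with ℕ.m≤n⇒m<n∨m≡n s≤τ
      ... | inj₁ s<τ = fresh S s<τ
      ... | inj₂ eq  = λ ws → x≢u (Fin.suc-injective (trans (sym wτ)
        (trans (cong (w S) (sym (Fin.toℕ-injective eq))) ws)))
    ... | yes x≡u with Fin.all? used?
    ...   | yes all-used = inj₁ (Last.outcome S moved all-used)
    ...   | no ¬all-used with least-failure used? ¬all-used
    ...     | u′ , ¬used , used = inj₂ (Next.next S τ⁺≡ (suc u′) u′ moved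
      (unguided S (λ eq → ¬used (τ , ℕ.≤-refl , trans wτ-u (sym eq)))
        (λ s<τ ws → ¬used (_ , ℕ.<⇒≤ s<τ , ws)))
      (λ s≤τ ws → ¬used (_ , s≤τ , ws)) used (inj₂ (sym wτ-u)) (inj₁ refl)
      (subst (λ y → pos y ℚ.≤ pos (suc u′)) (sym wτ-u) (d-mono (s≤s (ℕ.≮⇒≥ λ u′<u →
        let s , s<τ , ws = lower S u′ u′<u in ¬used (s , ℕ.<⇒≤ s<τ , ws)))))
      (cong (λ y → pos (suc u′) ℚ.- pos y) wτ-u))
      where
      wτ-u : w S τ ≡ suc (u S)
      wτ-u = trans wτ (cong suc x≡u)

  -- By `zero-later` every stage has a successor time, so with only k times the play can end only in
  -- an `Outcome`.
  play : (∀ {τ} (S : Stage τ) → w S τ ≢ zero) → Outcome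
  play never-zero = go k initial ℕ.≤-refl
    where
    go : ∀ fuel {τ} → Stage τ → k ℕ.≤ toℕ τ ℕ.+ fuel → Outcome
    go zero {τ} S k≤τ =
      contradiction (Fin.toℕ<n τ) (ℕ.≤⇒≯ (subst (k ℕ.≤_) (ℕ.+-identityʳ (toℕ τ)) k≤τ))
    go (suc fuel) {τ} S k≤τ+fuel with next-time (zero-later S)
    ... | τ⁺ , τ⁺≡ with step τ⁺≡ S (never-zero S)
    ...   | inj₁ outcome = outcome
    ...   | inj₂ S⁺ = go fuel S⁺ (subst (k ℕ.≤_)
      (trans (ℕ.+-suc (toℕ τ) fuel) (cong (ℕ._+ fuel) (sym τ⁺≡))) k≤τ+fuel)

  -- Using consistency and robustness

  module _ (ε : ℝ) (consistent : Consistent (1ℝ + ε) A) {g} (0<g : 0ℚ ℚ.< g)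
    (small : ∃ λ N → ∀ m → N ℕ.≤ m → seq ε m ℚ.* c ℚ.+ g ℚ.≤ 2ℚ) where

    -- The stage has perfect predictions and optimum cD, whereas a return to 0 costs at least 2D +
    -- cD. Since εc + g ≤ 2 eventually and 1 ≤ D, this exceeds (1 + ε)cD by at least g.
    no-deviation : ∀ {τ} (S : Stage τ) → w S τ ≢ zero
    no-deviation S wτ≡0 = cost-exceeds pos (req S) (M S ⟨$⟩ʳ_) A (1ℝ + ε) (c ℚ.* D) 0<g
      (proj₁ small , λ m N≤m → ℚ.≤-trans (bound (seq ε m) (proj₂ small m N≤m)) (deviation-cost S wτ≡0))
      (consistent (played S) (M S , M-optimal S , λ _ → refl) (fromℚ (c ℚ.* D))
        (optimal⇒IsOPT pos (req S) (M S ⟨$⟩ʳ_) (M S) (M-optimal S) (M-length S)))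
      where
      D = d c (toℕ (u S))

      bound : ∀ e → e ℚ.* c ℚ.+ g ℚ.≤ 2ℚ →
        (1ℚ ℚ.+ e) ℚ.* (c ℚ.* D) ℚ.+ g ℚ.≤ (D ℚ.+ D) ℚ.+ c ℚ.* D
      bound e ec+g≤2 = ≤-from-difference
        (ℚ.+-mono-≤ (*-monoˡ 0≤D ec+g≤2) (*-monoˡ (ℚ.<⇒≤ 0<g) (1≤d (toℕ (u S)))))
        (solve 4 (λ D e c g →
          (D :* (con 1ℚ :+ con 1ℚ) :+ g :* D) :- (D :* (e :* c :+ g) :+ g :* con 1ℚ) :=
          ((D :+ D) :+ c :* D) :- ((con 1ℚ :+ e) :* (c :* D) :+ g)) refl D e c g)
        where
        0≤D : 0ℚ ℚ.≤ D
        0≤D = ℚ.≤-trans 0≤1 (1≤d (toℕ (u S)))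

    robustness : ∀ r → Robust r A → fromℚ ((d c (suc n) ℚ.+ d c (suc n)) ℚ.- 1ℚ) ≤ r
    robustness r robust (δ , 0<δ , N , r+δ≤) = refute (play no-deviation)
      where
      refute : ¬ Outcome
      refute (req , pred , π , π-opt , π-length , cost≥) =
        cost-exceeds pos req pred A r 1ℚ 0<δ
          (N , λ m N≤m → ℚ.≤-trans
            (subst (λ x → x ℚ.+ δ ℚ.≤ (d c (suc n) ℚ.+ d c (suc n)) ℚ.- 1ℚ)
              (sym (ℚ.*-identityʳ (seq r m))) (r+δ≤ m N≤m)) cost≥)
          (robust (rational pos req pred) 1ℝ (optimal⇒IsOPT pos req pred π π-opt π-length))

-- The limit c → 2 / ε

d-pos : ∀ {c} → 0ℚ ℚ.≤ c → ∀ m → 0ℚ ℚ.≤ d c m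
d-pos 0≤c zero    = 0≤1
d-pos 0≤c (suc m) = ℚ.+-mono-≤ 0≤1 (0≤* 0≤c (d-pos 0≤c m))

d-monoˡ : ∀ {c C} → 0ℚ ℚ.≤ c → c ℚ.≤ C → ∀ m → d c m ℚ.≤ d C m
d-monoˡ 0≤c c≤C zero    = ℚ.≤-refl
d-monoˡ 0≤c c≤C (suc m) = ℚ.+-monoʳ-≤ 1ℚ (ℚ.≤-trans
  (*-monoʳ (d-pos 0≤c m) c≤C) (*-monoˡ (ℚ.≤-trans 0≤c c≤C) (d-monoˡ 0≤c c≤C m)))

-- A Lipschitz constant of c ↦ `d c m` on [0, B]; the recursion is the product rule for c times
-- `d c m`, with each factor bounded by its value at `B`.
lip : ℚ → ℕ → ℚ
lip B zero    = 0ℚ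
lip B (suc m) = B ℚ.* lip B m ℚ.+ d B m

lip-pos : ∀ {B} → 0ℚ ℚ.≤ B → ∀ m → 0ℚ ℚ.≤ lip B m
lip-pos 0≤B zero    = ℚ.≤-refl
lip-pos 0≤B (suc m) = ℚ.+-mono-≤ (0≤* 0≤B (lip-pos 0≤B m)) (d-pos 0≤B m)

d-lipschitz : ∀ {c C B} → 0ℚ ℚ.≤ c → c ℚ.≤ C → C ℚ.≤ B → ∀ m →
  d C m ℚ.- d c m ℚ.≤ lip B m ℚ.* (C ℚ.- c)
d-lipschitz {c} {C} {B} 0≤c c≤C C≤B zero = ℚ.≤-reflexive (sym (ℚ.*-zeroˡ (C ℚ.- c)))
d-lipschitz {c} {C} {B} 0≤c c≤C C≤B (suc m) = ≤-from-difference
  (ℚ.+-mono-≤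
    (ℚ.≤-trans (*-monoˡ (ℚ.≤-trans 0≤c c≤C) (d-lipschitz 0≤c c≤C C≤B m))
      (*-monoʳ (0≤* (lip-pos (ℚ.≤-trans 0≤c c≤B) m) (≤⇒0≤difference c≤C)) C≤B))
    (*-monoˡ (≤⇒0≤difference c≤C) (d-monoˡ 0≤c c≤B m)))
  (solve 7 (λ c C B x X K Y →
    (B :* (K :* (C :- c)) :+ (C :- c) :* Y) :- (C :* (X :- x) :+ (C :- c) :* x) :=
    (B :* K :+ Y) :* (C :- c) :- ((con 1ℚ :+ C :* X) :- (con 1ℚ :+ c :* x))) refl
    c C B (d c m) (d C m) (lip B m) (d B m))
  where
  c≤B : c ℚ.≤ B
  c≤B = ℚ.≤-trans c≤C C≤B

-- The prefactor `x` is arbitrary so that the induction can absorb one factor `c` into it.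
geometric : ∀ c x m → x ℚ.+ sum {m} (λ i → x ℚ.* (c ^ℚ suc (toℕ i))) ≡ x ℚ.* d c m
geometric c x zero    = trans (ℚ.+-identityʳ x) (sym (ℚ.*-identityʳ x))
geometric c x (suc m) = trans
  (cong (x ℚ.+_) (cong₂ ℚ._+_ (cong (x ℚ.*_) (ℚ.*-identityʳ c))
    (sum-cong-≗ {m} λ i → sym (ℚ.*-assoc x c (c ^ℚ suc (toℕ i))))))
  (trans (cong (x ℚ.+_) (geometric c (x ℚ.* c) m))
    (solve 3 (λ x c D → x :+ (x :* c) :* D := x :* (con 1ℚ :+ c :* D)) refl x c (d c m)))

reciprocal : ∀ e → 0ℚ ℚ.< e → ∃ λ i → 0ℚ ℚ.< i × e ℚ.* i ≡ 1ℚ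
reciprocal e 0<e = (ℚ.1/ e) {{nz}} , ℚ.positive⁻¹ _ {{ℚ.1/pos⇒pos e {{p}}}} , ℚ.*-inverseʳ e {{nz}}
  where
  p = ℚ.positive 0<e
  nz = ℚ.pos⇒nonZero e {{p}}

-- An inverse is built on a shifted tail, so a bound on its `m`-th term needs information about `x`
-- at the later index `s + m`.
seq-inverse : ∀ x 0<x m → ∃ λ s →
  0ℚ ℚ.≤ seq (inverse x 0<x) m × seq x (s ℕ.+ m) ℚ.* seq (inverse x 0<x) m ≡ 1ℚ
seq-inverse x (a , 0<a , s , bound) m = s , ℚ.<⇒≤ (proj₁ (proj₂ i)) , proj₂ (proj₂ i)
  where
  i = reciprocal (seq x (s ℕ.+ m)) (ℚ.<-≤-trans 0<a
    (subst (ℚ._≤ seq x (s ℕ.+ m)) (ℚ.+-identityˡ a) (bound (s ℕ.+ m) (ℕ.m≤m+n s m))))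

-- The division-free form of (2/ε)^j ≤ C^j.
power-bound : ∀ ε C i → 0ℚ ℚ.≤ C → 0ℚ ℚ.≤ seq ε i → 2ℚ ℚ.≤ seq ε i ℚ.* C → ∀ j →
  0ℚ ℚ.≤ seq (ε ^ j) i × ∀ m → seq (2ℝ ^ j) m ℚ.≤ seq (ε ^ j) i ℚ.* (C ^ℚ j)
power-bound ε C i 0≤C 0≤ε 2≤εC zero    = 0≤1 , λ m → ℚ.≤-refl
power-bound ε C i 0≤C 0≤ε 2≤εC (suc j) with power-bound ε C i 0≤C 0≤ε 2≤εC j
... | 0≤εʲ , 2ʲ≤ = 0≤* 0≤ε 0≤εʲ , λ m → ℚ.≤-trans
  (ℚ.≤-trans (*-monoˡ (ℚ.+-mono-≤ 0≤1 0≤1) (2ʲ≤ m)) (*-monoʳ (0≤* 0≤εʲ (power-pos j)) 2≤εC))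
  (ℚ.≤-reflexive (solve 4 (λ e C x y → (e :* C) :* (x :* y) := (e :* x) :* (C :* y)) refl
    (seq ε i) C (seq (ε ^ j) i) (C ^ℚ j)))
  where
  power-pos : ∀ j → 0ℚ ℚ.≤ C ^ℚ j
  power-pos zero    = 0≤1
  power-pos (suc j) = 0≤* 0≤C (power-pos j)

-- Replacing 2/ε by `C` turns `L` into 1 + 2(C + ⋯ + C^(k-1)), which is 2 d_{k-1} - 1 taken at `C`.
L-bound : ∀ n ε 0<ε C N → 0ℚ ℚ.≤ C →
  (∀ i → N ℕ.≤ i → 0ℚ ℚ.≤ seq ε i × 2ℚ ℚ.≤ seq ε i ℚ.* C) →
  ∀ m → N ℕ.≤ m → seq (L (suc (suc n)) ε 0<ε) m ℚ.≤ (d C (suc n) ℚ.+ d C (suc n)) ℚ.- 1ℚ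
L-bound n ε 0<ε C N 0≤C large m N≤m = ℚ.≤-trans
  (ℚ.+-monoʳ-≤ 1ℚ (ℚ.≤-trans
    (ℚ.≤-reflexive (seq-∑ {suc n} (λ i → real-term (suc (toℕ i))) m))
    (sum-mono {suc n} λ i → term≤ (suc (toℕ i)))))
  (ℚ.≤-reflexive (trans
    (solve 1 (λ s → con 1ℚ :+ s := ((con 1ℚ :+ con 1ℚ) :+ s) :- con 1ℚ) refl
      (sum {suc n} λ i → 2ℚ ℚ.* (C ^ℚ suc (toℕ i))))
    (trans (cong (ℚ._- 1ℚ) (geometric C 2ℚ (suc n)))
      (solve 1 (λ D → (con 1ℚ :+ con 1ℚ) :* D :- con 1ℚ := (D :+ D) :- con 1ℚ) refl (d C (suc n))))))
  where
  real-term : ℕ → ℝ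
  real-term j = (2ℝ ^ suc j) ÷ (ε ^ j) ⟨ ^-positive ε 0<ε j ⟩

  term≤ : ∀ j → seq (real-term j) m ℚ.≤ 2ℚ ℚ.* (C ^ℚ j)
  term≤ j with seq-inverse (ε ^ j) (^-positive ε 0<ε j) m
  ... | s , 0≤inv , eq with large (s ℕ.+ m) (ℕ.≤-trans N≤m (ℕ.m≤n+m m s))
  ...   | 0≤ε , 2≤εC = subst₂ ℚ._≤_ (sym (ℚ.*-assoc 2ℚ (seq (2ℝ ^ j) m) inv)) refl
    (*-monoˡ (ℚ.+-mono-≤ 0≤1 0≤1) (ℚ.≤-trans
      (*-monoʳ 0≤inv (proj₂ (power-bound ε C (s ℕ.+ m) 0≤C 0≤ε 2≤εC j) m))
      (ℚ.≤-reflexive (trans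
        (solve 3 (λ x y z → (x :* y) :* z := (x :* z) :* y) refl (seq (ε ^ j) (s ℕ.+ m)) (C ^ℚ j) inv)
        (trans (cong (ℚ._* (C ^ℚ j)) eq) (ℚ.*-identityˡ (C ^ℚ j)))))))
    where inv = seq (inverse (ε ^ j) (^-positive ε 0<ε j)) m

reciprocal-antitone : ∀ {e f i j} → e ℚ.* i ≡ 1ℚ → f ℚ.* j ≡ 1ℚ → 0ℚ ℚ.≤ i → 0ℚ ℚ.≤ j →
  e ℚ.≤ f → j ℚ.≤ i
reciprocal-antitone {e} {f} {i} {j} ei≡1 fj≡1 0≤i 0≤j e≤f = subst₂ ℚ._≤_
  (trans (cong (ℚ._* j) ei≡1) (ℚ.*-identityˡ j))
  (trans (solve 3 (λ f i j → (f :* i) :* j := i :* (f :* j)) refl f i j)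
    (trans (cong (i ℚ.*_) fj≡1) (ℚ.*-identityʳ i)))
  (*-monoʳ 0≤j (*-monoʳ 0≤i e≤f))

-- c < 2 / ε ≤ C, stated without division; the gap g is what makes the first strict.
record Bracket (ε : ℝ) (h b η : ℚ) : Set where
  field
    c C g : ℚ
    N     : ℕ
    0≤c   : 0ℚ ℚ.≤ c
    c≤C   : c ℚ.≤ C
    C≤    : C ℚ.≤ 2ℚ ℚ.* b
    close : C ℚ.- c ℚ.≤ 2ℚ ℚ.* ((b ℚ.* b) ℚ.* (η ℚ.+ η ℚ.+ η))
    0<g   : 0ℚ ℚ.< g
    outer : ∀ m → N ℕ.≤ m → 0ℚ ℚ.≤ seq ε m × 2ℚ ℚ.≤ seq ε m ℚ.* C
    inner : ∀ m → N ℕ.≤ m → seq ε m ℚ.* c ℚ.+ g ℚ.≤ 2ℚ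

-- From `N` on, ε stays within `η` of `x = seq ε N`; take C = 2/(x - η) and c = 2/(x + 2η). The
-- bound `h` keeps both denominators away from 0, and `b = 1/h` bounds their reciprocals.
bracket : ∀ ε h b η → 0ℚ ℚ.< h → h ℚ.* b ≡ 1ℚ → 0ℚ ℚ.≤ b → 0ℚ ℚ.< η → η ℚ.≤ h →
  (∃ λ N → ∀ m → N ℕ.≤ m → h ℚ.+ h ℚ.≤ seq ε m) → Bracket ε h b η
bracket ε h b η 0<h hb≡1 0≤b 0<η η≤h (N₀ , 2h≤) with cauchy ε η 0<η
... | N₁ , near = record
  { c = 2ℚ ℚ.* i′ ; C = 2ℚ ℚ.* i ; g = η ℚ.* (2ℚ ℚ.* i′) ; N = N
  ; 0≤c = 0≤* 0≤2 0≤i′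
  ; c≤C = *-monoˡ 0≤2 (reciprocal-antitone ei≡1 e′i′≡1 0≤i 0≤i′ e≤e′)
  ; C≤ = *-monoˡ 0≤2 i≤b
  ; close = ℚ.≤-trans (ℚ.≤-reflexive difference)
      (*-monoˡ 0≤2 (*-monoʳ 0≤3η (ℚ.≤-trans (*-monoˡ 0≤i i′≤b) (*-monoʳ 0≤b i≤b))))
  ; 0<g = 0<* 0<η (0<* (ℚ.positive⁻¹ 2ℚ) 0<i′)
  ; outer = λ m N≤m → ℚ.≤-trans (ℚ.<⇒≤ 0<e) (e≤ m N≤m) , ℚ.≤-trans
      (ℚ.≤-reflexive (sym (doubled e i ei≡1))) (*-monoʳ (0≤* 0≤2 0≤i) (e≤ m N≤m))
  ; inner = λ m N≤m → ℚ.≤-trans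
      (ℚ.≤-reflexive (sym (ℚ.*-distribʳ-+ (2ℚ ℚ.* i′) (seq ε m) η)))
      (ℚ.≤-trans (*-monoʳ (0≤* 0≤2 0≤i′) (≤e′ m N≤m)) (ℚ.≤-reflexive (doubled e′ i′ e′i′≡1)))
  }
  where
  N = N₀ ℕ.+ N₁
  x = seq ε N
  e = x ℚ.- η
  -- One `η` covers the variation of ε; the second leaves room for the positive gap `g`.
  e′ = x ℚ.+ η ℚ.+ η

  0≤2 : 0ℚ ℚ.≤ 2ℚ
  0≤2 = ℚ.+-mono-≤ 0≤1 0≤1

  0≤η : 0ℚ ℚ.≤ η
  0≤η = ℚ.<⇒≤ 0<η

  0≤3η : 0ℚ ℚ.≤ η ℚ.+ η ℚ.+ η
  0≤3η = ℚ.+-mono-≤ (ℚ.+-mono-≤ 0≤η 0≤η) 0≤η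

  h≤e : h ℚ.≤ e
  h≤e = ≤-from-difference (ℚ.+-mono-≤ (2h≤ N (ℕ.m≤m+n N₀ N₁)) η≤h)
    (solve 3 (λ h x η → (x :+ h) :- (h :+ h :+ η) := (x :- η) :- h) refl h x η)

  e≤e′ : e ℚ.≤ e′
  e≤e′ = ≤-from-difference 0≤3η
    (solve 2 (λ x η → (η :+ η :+ η) :- con 0ℚ := (x :+ η :+ η) :- (x :- η)) refl x η)

  0<e : 0ℚ ℚ.< e
  0<e = ℚ.<-≤-trans 0<h h≤e

  near-N : ∀ m → N ℕ.≤ m → ℚ.∣ seq ε m ℚ.- x ∣ ℚ.≤ η
  near-N m N≤m = ℚ.<⇒≤ (near m N (ℕ.m+n≤o⇒n≤o N₀ N≤m) (ℕ.m≤n+m N₁ N₀))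

  e≤ : ∀ m → N ℕ.≤ m → e ℚ.≤ seq ε m
  e≤ m N≤m = ≤-from-difference (ℚ.≤-trans (b-a≤∣a-b∣ (seq ε m) x) (near-N m N≤m))
    (solve 3 (λ y x η → η :- (x :- y) := y :- (x :- η)) refl (seq ε m) x η)

  ≤e′ : ∀ m → N ℕ.≤ m → seq ε m ℚ.+ η ℚ.≤ e′
  ≤e′ m N≤m = ≤-from-difference (ℚ.≤-trans (a-b≤∣a-b∣ (seq ε m) x) (near-N m N≤m))
    (solve 3 (λ y x η → η :- (y :- x) := (x :+ η :+ η) :- (y :+ η)) refl (seq ε m) x η)

  e⁻¹ = reciprocal e 0<e
  e′⁻¹ = reciprocal e′ (ℚ.<-≤-trans 0<e e≤e′)
  i = proj₁ e⁻¹
  i′ = proj₁ e′⁻¹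
  ei≡1 = proj₂ (proj₂ e⁻¹)
  e′i′≡1 = proj₂ (proj₂ e′⁻¹)
  0<i′ = proj₁ (proj₂ e′⁻¹)
  0≤i = ℚ.<⇒≤ (proj₁ (proj₂ e⁻¹))
  0≤i′ = ℚ.<⇒≤ 0<i′

  i≤b : i ℚ.≤ b
  i≤b = reciprocal-antitone hb≡1 ei≡1 0≤b 0≤i h≤e

  i′≤b : i′ ℚ.≤ b
  i′≤b = reciprocal-antitone hb≡1 e′i′≡1 0≤b 0≤i′ (ℚ.≤-trans h≤e e≤e′)

  doubled : ∀ e i → e ℚ.* i ≡ 1ℚ → e ℚ.* (2ℚ ℚ.* i) ≡ 2ℚ
  doubled e i ei≡1 = trans
    (solve 2 (λ e i → e :* ((con 1ℚ :+ con 1ℚ) :* i) := (con 1ℚ :+ con 1ℚ) :* (e :* i)) refl e i)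
    (cong (2ℚ ℚ.*_) ei≡1)

  difference : 2ℚ ℚ.* i ℚ.- 2ℚ ℚ.* i′ ≡ 2ℚ ℚ.* ((i ℚ.* i′) ℚ.* (η ℚ.+ η ℚ.+ η))
  difference = begin
    2ℚ ℚ.* i ℚ.- 2ℚ ℚ.* i′
      ≡⟨ solve 2 (λ i i′ → (con 1ℚ :+ con 1ℚ) :* i :- (con 1ℚ :+ con 1ℚ) :* i′ :=
           (con 1ℚ :+ con 1ℚ) :* (i :* con 1ℚ :- i′ :* con 1ℚ)) refl i i′ ⟩
    2ℚ ℚ.* (i ℚ.* 1ℚ ℚ.- i′ ℚ.* 1ℚ)
      ≡⟨ cong₂ (λ p q → 2ℚ ℚ.* (i ℚ.* p ℚ.- i′ ℚ.* q)) e′i′≡1 ei≡1 ⟨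
    2ℚ ℚ.* (i ℚ.* (e′ ℚ.* i′) ℚ.- i′ ℚ.* (e ℚ.* i))
      ≡⟨ cong (2ℚ ℚ.*_) (solve 4 (λ i i′ x η →
           i :* ((x :+ η :+ η) :* i′) :- i′ :* ((x :- η) :* i) :=
           (i :* i′) :* (η :+ η :+ η)) refl i i′ x η) ⟩
    2ℚ ℚ.* ((i ℚ.* i′) ℚ.* (η ℚ.+ η ℚ.+ η)) ∎
    where open ≡-Reasoning

-- Choice of the precision `η`

half+half : ∀ p → p ℚ.* ½ ℚ.+ p ℚ.* ½ ≡ p
half+half = solve 1 (λ p → p :* con ½ :+ p :* con ½ := p) refl

half-pos : ∀ {p} → 0ℚ ℚ.< p → 0ℚ ℚ.< p ℚ.* ½
half-pos 0<p = 0<* 0<p (ℚ.positive⁻¹ ½)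

⊓-pos : ∀ {p q} → 0ℚ ℚ.< p → 0ℚ ℚ.< q → 0ℚ ℚ.< p ℚ.⊓ q
⊓-pos {p} {q} 0<p 0<q with ℚ.⊓-sel p q
... | inj₁ eq = subst (0ℚ ℚ.<_) (sym eq) 0<p
... | inj₂ eq = subst (0ℚ ℚ.<_) (sym eq) 0<q

-- Dividing by `T + 1` avoids treating `T = 0` separately.
small-multiple : ∀ T h δ → 0ℚ ℚ.≤ T → 0ℚ ℚ.< h → 0ℚ ℚ.< δ →
  ∃ λ η → 0ℚ ℚ.< η × η ℚ.≤ h × T ℚ.* η ℚ.≤ δ
small-multiple T h δ 0≤T 0<h 0<δ = go (reciprocal (T ℚ.+ 1ℚ) 0<T+1)
  where
  0<T+1 : 0ℚ ℚ.< T ℚ.+ 1ℚ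
  0<T+1 = ℚ.+-mono-≤-< 0≤T (ℚ.positive⁻¹ 1ℚ)

  go : (∃ λ t → 0ℚ ℚ.< t × (T ℚ.+ 1ℚ) ℚ.* t ≡ 1ℚ) → _
  go (t , 0<t , eq) = η , 0<η , ℚ.p⊓q≤p h (t ℚ.* δ) , ≤-from-difference
    (ℚ.+-mono-≤ (*-monoˡ (ℚ.<⇒≤ 0<T+1) (ℚ.p⊓q≤q h (t ℚ.* δ))) (ℚ.<⇒≤ 0<η))
    (trans (cong (λ y → (y ℚ.+ η) ℚ.- ((T ℚ.+ 1ℚ) ℚ.* η ℚ.+ 0ℚ))
        (trans (sym (ℚ.*-assoc (T ℚ.+ 1ℚ) t δ))
          (trans (cong (ℚ._* δ) eq) (ℚ.*-identityˡ δ))))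
      (solve 3 (λ T η f → (f :+ η) :- ((T :+ con 1ℚ) :* η :+ con 0ℚ) := f :- T :* η) refl T η δ))
    where
    η = h ℚ.⊓ (t ℚ.* δ)
    0<η : 0ℚ ℚ.< η
    0<η = ⊓-pos 0<h (0<* 0<t 0<δ)

L-approximation : ∀ n ε 0<ε δ → 0ℚ ℚ.< δ → ∃ λ c → ∃ λ g → 0ℚ ℚ.≤ c × 0ℚ ℚ.< g ×
  (∃ λ N → ∀ m → N ℕ.≤ m → seq ε m ℚ.* c ℚ.+ g ℚ.≤ 2ℚ) ×
  (∃ λ N → ∀ m → N ℕ.≤ m →
    seq (L (suc (suc n)) ε 0<ε) m ℚ.≤ ((d c (suc n) ℚ.+ d c (suc n)) ℚ.- 1ℚ) ℚ.+ δ)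
L-approximation n ε 0<ε@(a , 0<a , N₀ , a≤ε) δ 0<δ = from-b (reciprocal h (half-pos 0<a))
  where
  h = a ℚ.* ½

  Goal : Set
  Goal = ∃ λ c → ∃ λ g → 0ℚ ℚ.≤ c × 0ℚ ℚ.< g ×
    (∃ λ N → ∀ m → N ℕ.≤ m → seq ε m ℚ.* c ℚ.+ g ℚ.≤ 2ℚ) ×
    (∃ λ N → ∀ m → N ℕ.≤ m →
      seq (L (suc (suc n)) ε 0<ε) m ℚ.≤ ((d c (suc n) ℚ.+ d c (suc n)) ℚ.- 1ℚ) ℚ.+ δ)

  from-b : (∃ λ b → 0ℚ ℚ.< b × h ℚ.* b ≡ 1ℚ) → Goal
  from-b (b , 0<b , hb≡1) = from-η (small-multiple T h δ 0≤T (half-pos 0<a) 0<δ)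
    where
    0≤b : 0ℚ ℚ.≤ b
    0≤b = ℚ.<⇒≤ 0<b

    K 12ℚ T : ℚ
    K = lip (2ℚ ℚ.* b) (suc n)
    -- One factor 2 comes from doubling `d`, the other from the numerator of 2/ε, and 3 from the
    -- difference 3η of the two denominators.
    12ℚ = 2ℚ ℚ.* (2ℚ ℚ.* (1ℚ ℚ.+ 1ℚ ℚ.+ 1ℚ))
    T = (K ℚ.* (b ℚ.* b)) ℚ.* 12ℚ

    0≤K : 0ℚ ℚ.≤ K
    0≤K = lip-pos (0≤* (ℚ.+-mono-≤ 0≤1 0≤1) 0≤b) (suc n)

    0≤T : 0ℚ ℚ.≤ T
    0≤T = 0≤* (0≤* 0≤K (0≤* 0≤b 0≤b)) (ℚ.nonNegative⁻¹ 12ℚ)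

    from-η : (∃ λ η → 0ℚ ℚ.< η × η ℚ.≤ h × T ℚ.* η ℚ.≤ δ) → Goal
    from-η (η , 0<η , η≤h , Tη≤δ) = from-bracket
      (bracket ε h b η (half-pos 0<a) hb≡1 0≤b 0<η η≤h
        (N₀ , λ m N₀≤m → subst (ℚ._≤ seq ε m)
          (trans (ℚ.+-identityˡ a) (sym (half+half a))) (a≤ε m N₀≤m)))
      where
      from-bracket : Bracket ε h b η → Goal
      from-bracket br = c , g , 0≤c , 0<g , (N , inner) , N , λ m N≤m → ≤-from-difference
        (ℚ.+-mono-≤ (L-bound n ε 0<ε C N (ℚ.≤-trans 0≤c c≤C) outer m N≤m)
          (ℚ.≤-trans (ℚ.+-mono-≤ dC-dc≤ dC-dc≤) (ℚ.≤-trans (ℚ.≤-reflexive twelve) Tη≤δ)))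
        (solve 4 (λ x y l f → (((x :+ x) :- con 1ℚ) :+ f) :- (l :+ ((x :- y) :+ (x :- y))) :=
          (((y :+ y) :- con 1ℚ) :+ f) :- l) refl
          (d C (suc n)) (d c (suc n)) (seq (L (suc (suc n)) ε 0<ε) m) δ)
        where
        open Bracket br

        dC-dc≤ : d C (suc n) ℚ.- d c (suc n) ℚ.≤ K ℚ.* (2ℚ ℚ.* ((b ℚ.* b) ℚ.* (η ℚ.+ η ℚ.+ η)))
        dC-dc≤ = ℚ.≤-trans (d-lipschitz 0≤c c≤C C≤ (suc n)) (*-monoˡ 0≤K close)

        twelve : K ℚ.* (2ℚ ℚ.* ((b ℚ.* b) ℚ.* (η ℚ.+ η ℚ.+ η))) ℚ.+
          K ℚ.* (2ℚ ℚ.* ((b ℚ.* b) ℚ.* (η ℚ.+ η ℚ.+ η))) ≡ T ℚ.* η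
        twelve = solve 3 (λ K b η →
          let 2′ = con 1ℚ :+ con 1ℚ ; x = K :* (2′ :* ((b :* b) :* (η :+ η :+ η))) in
          x :+ x := ((K :* (b :* b)) :* (2′ :* (2′ :* (con 1ℚ :+ con 1ℚ :+ con 1ℚ)))) :* η) refl K b η

theorem2 : (k : ℕ) → 2 ℕ.≤ k → (ε : ℝ) (0<ε : 0ℝ < ε) →
    (A : Algorithm k) → Consistent (1ℝ + ε) A →
    (r : ℝ) → Robust r A → L k ε 0<ε ≤ r
theorem2 (suc (suc n)) (s≤s (s≤s z≤n)) ε 0<ε A consistent r robust (δ , 0<δ , N , r+δ≤L) =
  -- Half of the gap `δ` pays for approximating `L`; the other half still separates `r` from 2
  -- d_{k-1} - 1.
  refute (L-approximation n ε 0<ε (δ ℚ.* ½) (half-pos 0<δ))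
  where
  refute : ¬ _
  refute (c , g , 0≤c , 0<g , small , N′ , L≤) =
    Adversary.robustness A c 0≤c ε consistent 0<g small r robust
      (δ ℚ.* ½ , half-pos 0<δ , N ℕ.+ N′ , λ m ≤m → ≤-from-difference
        (ℚ.≤-trans (r+δ≤L m (ℕ.m+n≤o⇒m≤o N ≤m)) (L≤ m (ℕ.m+n≤o⇒n≤o N ≤m)))
        (trans (cong (λ y → (R ℚ.+ δ ℚ.* ½) ℚ.- (seq r m ℚ.+ y)) (sym (half+half δ)))
          (solve 3 (λ R s f → (R :+ f) :- (s :+ (f :+ f)) := R :- (s :+ f)) refl
            R (seq r m) (δ ℚ.* ½))))
    where
    R = (d c (suc n) ℚ.+ d c (suc n)) ℚ.- 1ℚ
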